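{- Let $q\ge 2$ be an integer and let $T$ be the $q$-valent rooted tree. Let $D$ be a nonempty countable descendant-homogeneous digraph such that for every vertex $u$ of $D$ the descendant set ${\rm desc}(u)$ (as an induced subdigraph) is isomorphic to $T$. Then $D$ is isomorphic to $D_n$ for some $n\in\{2,3,\ldots\}\cup\{\infty\}$.
   Context: Subdigraph means full induced subdigraph. For a digraph $D$ and $s\ge 0$, an $s$-arc from $u_0$ to $u_s$ is a sequence $u_0u_1\ldots u_s$ of vertices with $(u_i,u_{i+1})$ an edge for $0\le i<s$ and $u_{i-1}\ne u_{i+1}$ for $0<i<s$. ${\rm desc}^s(u)$ is the set of $v$ such that there is an $s$-arc from $u$ to $v$, and ${\rm desc}(u)=\bigcup_{s\ge0}{\rm desc}^s(u)$; for a set $X$, ${\rm desc}(X)=\bigcup_{x\in X}{\rm desc}(x)$. A subset $A$ of $D$ is descendant-closed, written $A\le D$, if ${\rm desc}_D(a)\subseteq A$ for all $a\in A$; $A\le D$ is finitely generated if $A={\rm desc}_D(X)$ for some finite $X$. A digraph is descendant-homogeneous if every isomorphism between finitely generated descendant-closed subdigraphs extends to an automorphism. $T=T_q$ has as vertices the finite sequences over $\{0,\ldots,q-1\}$ and edges $(\bar w,\bar wi)$. Let $\mathcal C$ be the class of digraphs $A$ such that ${\rm desc}_A(a)\cong T$ for all $a\in A$, $A$ is finitely generated, and ${\rm desc}(a)\cap{\rm desc}(b)$ is finitely generated for all $a,b\in A$. For $n\ge2$, let $\mathcal T_n$ be the digraph obtained from $T$ by deleting the root and adding $n$ new vertices $x_1,\ldots,x_n$,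 each with edges to all $q$ children of the deleted root (so ${\rm desc}^1(x_i)={\rm desc}^1(x_j)$); let $\mathcal C_n$ be the class of $A\in\mathcal C$ into which $\mathcal T_n$ does not embed as a descendant-closed subdigraph. It is known that there is a countable descendant-homogeneous digraph $D_\infty$, unique up to isomorphism, whose finitely generated descendant-closed subdigraphs are up to isomorphism exactly the members of $\mathcal C$, and for each $n\ge2$ a countable descendant-homogeneous digraph $D_n$, unique up to isomorphism, whose finitely generated descendant-closed subdigraphs are up to isomorphism exactly the members of $\mathcal C_n$. -}

module Defs where

open import Data.Nat using (ℕ; _≤_)
open import Data.Fin using (Fin)
open import Data.List using (List; []; _∷_; _∷ʳ_)
open import Data.List.Relation.Unary.Any using (Any)
open import Data.Product using (Σ; ∃; _×_; _,_)
open import Data.Sum using (_⊎_)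
open import Data.Unit using (⊤)
open import Data.Empty using (⊥)
open import Relation.Nullary using (¬_)
open import Relation.Binary.PropositionalEquality using (_≡_)
open import Function.Bundles using (_⇔_)
open import Function.Definitions using (Injective)

record Digraph : Set₁ where
  field
    V : Set
    E : V → V → Set
open Digraph public

Countable : Digraph → Set
Countable G = Σ (V G → ℕ) λ f → Injective _≡_ _≡_ f

Full : (G : Digraph) → V G → Set
Full G _ = ⊤

record SubIso (G H : Digraph) (P : V G → Set) (Q : V H → Set) : Set where
  field
    to      : (v : V G) → P v → V H
    to-Q    : (v : V G) (p : P v) → Q (to v p)
    from    : (w : V H) → Q w → V G
    from-P  : (w : V H) (q : Q w) → P (from w q)
    to-irr  : (v : V G) (p p′ : P v) → to v p ≡ to v p′
    from-irr : (w : V H) (q q′ : Q w) → from w q ≡ from w q′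
    left    : (v : V G) (p : P v) → from (to v p) (to-Q v p) ≡ v
    right   : (w : V H) (q : Q w) → to (from w q) (from-P w q) ≡ w
    edges   : (u v : V G) (p : P u) (p′ : P v) →
              E G u v ⇔ E H (to u p) (to v p′)
open SubIso public

Iso : Digraph → Digraph → Set
Iso G H = SubIso G H (Full G) (Full H)

-- s-arcs and descendants.
-- An arc u₀u₁…u_s is represented by its start u₀ and the list u₁…u_s.

NoBack : {A : Set} → A → List A → Set
NoBack u []      = ⊤
NoBack u (w ∷ _) = ¬ (u ≡ w)

IsArc : (G : Digraph) → V G → List (V G) → Set
IsArc G u []       = ⊤
IsArc G u (v ∷ rs) = E G u v × NoBack u rs × IsArc G v rs

endpoint : {A : Set} → A → List A → A
endpoint u []       = u
endpoint u (v ∷ rs) = endpoint v rs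

desc : (G : Digraph) → V G → V G → Set
desc G u v = Σ (List (V G)) λ rs → IsArc G u rs × endpoint u rs ≡ v

descL : (G : Digraph) → List (V G) → V G → Set
descL G X v = Any (λ x → desc G x v) X

DescClosed : (G : Digraph) → (V G → Set) → Set
DescClosed G A = (a v : V G) → A a → desc G a v → A v

FinGen : (G : Digraph) → (V G → Set) → Set
FinGen G A = DescClosed G A ×
  Σ (List (V G)) λ X → (v : V G) → A v ⇔ descL G X v

DescHomogeneous : Digraph → Set₁
DescHomogeneous G =
  (A B : V G → Set) → FinGen G A → FinGen G B → (f : SubIso G G A B) →
  Σ (Iso G G) λ σ → (v : V G) (p : A v) → to σ v _ ≡ to f v p

data TEdge (q : ℕ) : List (Fin q) → List (Fin q) → Set where
  child : (w : List (Fin q)) (i : Fin q) → TEdge q w (w ∷ʳ i)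

Tree : ℕ → Digraph
Tree q = record { V = List (Fin q) ; E = TEdge q }

-- 𝒯_n: T with root deleted, plus n new vertices x₁…x_n each joined to all
-- q children of the deleted root.  Old vertex (i , w) stands for the
-- nonempty sequence i w.

data TnV (q n : ℕ) : Set where
  old : Fin q → List (Fin q) → TnV q n
  new : Fin n → TnV q n

data TnEdge (q n : ℕ) : TnV q n → TnV q n → Set where
  oldE : (i : Fin q) (w : List (Fin q)) (k : Fin q) →
         TnEdge q n (old i w) (old i (w ∷ʳ k))
  newE : (x : Fin n) (i : Fin q) → TnEdge q n (new x) (old i [])

𝒯 : ℕ → ℕ → Digraph
𝒯 q n = record { V = TnV q n ; E = TnEdge q n }

InC : ℕ → Digraph → Set
InC q A =
  ((a : V A) → SubIso A (Tree q) (desc A a) (Full (Tree q))) ×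
  (Σ (List (V A)) λ X → (v : V A) → descL A X v) ×
  ((a b : V A) → FinGen A (λ v → desc A a v × desc A b v))

record DCEmbedding (H G : Digraph) : Set where
  field
    emb       : V H → V G
    emb-inj   : Injective _≡_ _≡_ emb
    emb-edges : (u v : V H) → E H u v ⇔ E G (emb u) (emb v)
    emb-closed : DescClosed G (λ w → Σ (V H) λ x → emb x ≡ w)

InCn : ℕ → ℕ → Digraph → Set
InCn q n A = InC q A × ¬ DCEmbedding (𝒯 q n) A

-- "The finitely generated descendant-closed subdigraphs of G are, up to
-- isomorphism, exactly the members of the class K", together with G being
-- countable and descendant-homogeneous: the defining property of D_∞ / D_n.
Characterises : (Digraph → Set) → Digraph → Set₁
Characterises K G =
  Countable G × DescHomogeneous G ×
  ((B : V G → Set) → FinGen G B →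
     Σ Digraph λ A → K A × SubIso A G (Full A) B) ×
  ((A : Digraph) → K A →
     Σ (V G → Set) λ B → FinGen G B × SubIso A G (Full A) B)

{-# OPTIONS --safe #-}
module Submission where

-- A descendant-homogeneous D with tree-like descendant sets is rebuilt from finitely
-- generated pieces.  Countability forces desc a ∩ desc b to be finitely generated: otherwise
-- the tree automorphisms of desc a, all of which extend to D, would move it to uncountably
-- many sets.  Hence a partial isomorphism between finitely generated closed parts of two
-- such digraphs extends to a further vertex w by adding finitely many disjoint cones and
-- then, upwards, single vertices all of whose children are already present.  Disjoint
-- cones are always available; new common parents of q independent vertices are available
-- as long as the other digraph has no fewer of them, which by homogeneity depends only
-- on the set of m for which 𝒯 m embeds.  So this set, an initial segment of ℕ, determines
-- D by back-and-forth, and D_n or D_∞ realises it.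

open import Defs
open import Data.Nat using (ℕ; zero; suc; _+_; _≤_; _<_; z≤n; s≤s)
open import Data.Nat.Induction using (<-rec)
import Data.Nat.Properties as ℕₚ
open import Data.Fin using (Fin; zero; suc; punchIn; punchOut; inject≤)
open import Data.Fin.Permutation.Components using (transpose; transpose-inverse)
import Data.Fin.Properties as Finₚ
open import Data.List using (List; []; _∷_; _∷ʳ_; _++_; map; concat; length; lookup; reverse; allFin)
import Data.List.Properties as Listₚ
open import Data.List.Membership.Propositional using (lose)
open import Data.List.Membership.Propositional.Properties using (∈-allFin)
open import Data.List.Relation.Unary.All as All using (All; []; _∷_)
import Data.List.Relation.Unary.All.Properties as Allₚ
open import Data.List.Relation.Unary.Any as Any using (Any; here; there)
import Data.List.Relation.Unary.Any.Properties as Anyₚ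
open import Data.Product using (Σ; ∃; _×_; _,_; proj₁; proj₂; swap)
open import Data.Sum using (_⊎_; inj₁; inj₂; [_,_]′)
open import Data.Unit using (tt)
open import Data.Empty using (⊥; ⊥-elim)
open import Function using (_∘_; flip)
open import Function.Bundles using (_⇔_; mk⇔; module Equivalence)
open import Relation.Nullary using (¬_; yes; no)
open import Relation.Binary.PropositionalEquality using (_≡_; _≢_; refl; sym; trans; cong; cong₂; subst; subst₂)
open import Relation.Binary.Construct.Closure.ReflexiveTransitive using (Star; ε; _◅_; _◅◅_; gmap)
open import Axiom.ExcludedMiddle using (ExcludedMiddle)
open import Level using (Level; 0ℓ)

open Equivalence using () renaming (to to ⇒; from to ⇐)

-- Paths and descendant-closed embeddings.

Path : (G : Digraph) → V G → V G → Set
Path G = Star (E G)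

desc⇒path : (G : Digraph) {u v : V G} → desc G u v → Path G u v
desc⇒path G (rs , arc , end) = go rs arc end
  where
  go : ∀ {u v} rs → IsArc G u rs → endpoint u rs ≡ v → Path G u v
  go []       _             refl = ε
  go (_ ∷ rs) (e , _ , arc) end  = e ◅ go rs arc end

-- A backtrack u w u at the start of the walk is cancelled.
path⇒desc : ExcludedMiddle 0ℓ → (G : Digraph) {u v : V G} → Path G u v → desc G u v
path⇒desc lem G ε = [] , tt , refl
path⇒desc lem G {u} (_◅_ {j = w} e p) with path⇒desc lem G p
... | []     , arc , end = w ∷ [] , (e , tt , tt) , end
... | x ∷ rs , arc , end with lem {P = u ≡ x}
...   | yes refl = rs , proj₂ (proj₂ arc) , end
...   | no u≢x   = w ∷ x ∷ rs , (e , u≢x , arc) , end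

-- `back` makes the image descendant-closed and, with `inj`, makes it an induced subdigraph.
-- Descendant-closed embeddings are thus described by single edges, without s-arcs.
record Emb (A G : Digraph) : Set where
  field
    fun   : V A → V G
    inj   : ∀ {u v} → fun u ≡ fun v → u ≡ v
    forth : ∀ {u v} → E A u v → E G (fun u) (fun v)
    back  : ∀ {u v} → E G (fun u) v → ∃ λ u′ → E A u u′ × fun u′ ≡ v

  path : ∀ {u v} → Path A u v → Path G (fun u) (fun v)
  path = gmap fun forth

  lift : ∀ {u v} → Path G (fun u) v → ∃ λ u′ → Path A u u′ × fun u′ ≡ v
  lift ε = _ , ε , refl
  lift (e ◅ p) with back e
  ... | _ , e′ , refl with lift p
  ...   | u″ , p′ , eq = u″ , e′ ◅ p′ , eq

  path⁻ : ∀ {u v} → Path G (fun u) (fun v) → Path A u v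
  path⁻ p with lift p
  ... | _ , p′ , eq with inj eq
  ...   | refl = p′

  edge⁻ : ∀ {u v} → E G (fun u) (fun v) → E A u v
  edge⁻ e with back e
  ... | _ , e′ , eq with inj eq
  ...   | refl = e′
open Emb public

infixr 9 _∘ᴱ_
_∘ᴱ_ : ∀ {A B C} → Emb B C → Emb A B → Emb A C
f ∘ᴱ e = record
  { fun   = fun f ∘ fun e
  ; inj   = inj e ∘ inj f
  ; forth = forth f ∘ forth e
  ; back  = λ d → let _ , d′ , eq′ = back f d
                      u , d″ , eq  = back e d′
                  in u , d″ , trans (cong (fun f) eq) eq′
  }

Image : ∀ {A G} → Emb A G → V G → Set
Image e v = ∃ λ u → fun e u ≡ v

-- Partial isomorphisms as relations, and their finite generation.

Relation : Digraph → Digraph → Set₁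
Relation G H = V G → V H → Set

Dom : {A B : Set} → (A → B → Set) → A → Set
Dom R u = ∃ (R u)

Cod : {A B : Set} → (A → B → Set) → B → Set
Cod R = Dom (flip R)

-- A relation of this kind is the graph of an isomorphism between
-- descendant-closed subdigraphs: being a bisimulation, it has closed domain
-- and codomain, and together with injectivity it respects edges both ways.
record PartialIso (G H : Digraph) (R : Relation G H) : Set where
  field
    functional : ∀ {u v v′} → R u v → R u v′ → v ≡ v′
    injective  : ∀ {u u′ v} → R u v → R u′ v → u ≡ u′
    zig        : ∀ {u v u′} → R u v → E G u u′ → ∃ λ v′ → E H v v′ × R u′ v′
    zag        : ∀ {u v v′} → R u v → E H v v′ → ∃ λ u′ → E G u u′ × R u′ v′

  zig* : ∀ {u v u′} → R u v → Path G u u′ → ∃ λ v′ → Path H v v′ × R u′ v′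
  zig* r ε = _ , ε , r
  zig* r (e ◅ p) with zig r e
  ... | _ , e′ , r′ with zig* r′ p
  ...   | v″ , p′ , r″ = v″ , e′ ◅ p′ , r″

  edge⇒ : ∀ {u v u′ v′} → R u v → R u′ v′ → E G u u′ → E H v v′
  edge⇒ r r′ e with zig r e
  ... | _ , e′ , r″ with functional r′ r″
  ...   | refl = e′
open PartialIso public

converse : ∀ {G H R} → PartialIso G H R → PartialIso H G (flip R)
converse P = record { functional = injective P ; injective = functional P ; zig = zag P ; zag = zig P }

_∪_ : {A B : Set} (R S : A → B → Set) → A → B → Set
(R ∪ S) u v = R u v ⊎ S u v

union : ∀ {G H R S} → PartialIso G H R → PartialIso G H S →
        (∀ {u v v′} → R u v → S u v′ → v ≡ v′) →
        (∀ {u u′ v} → R u v → S u′ v → u ≡ u′) →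
        PartialIso G H (R ∪ S)
union P Q fun-compat inj-compat = record
  { functional = λ { (inj₁ r) (inj₁ r′) → functional P r r′
                   ; (inj₁ r) (inj₂ s′) → fun-compat r s′
                   ; (inj₂ s) (inj₁ r′) → sym (fun-compat r′ s)
                   ; (inj₂ s) (inj₂ s′) → functional Q s s′ }
  ; injective  = λ { (inj₁ r) (inj₁ r′) → injective P r r′
                   ; (inj₁ r) (inj₂ s′) → inj-compat r s′
                   ; (inj₂ s) (inj₁ r′) → sym (inj-compat r′ s)
                   ; (inj₂ s) (inj₂ s′) → injective Q s s′ }
  ; zig = λ { (inj₁ r) e → let v , e′ , r′ = zig P r e in v , e′ , inj₁ r′
            ; (inj₂ s) e → let v , e′ , s′ = zig Q s e in v , e′ , inj₂ s′ }
  ; zag = λ { (inj₁ r) e → let v , e′ , r′ = zag P r e in v , e′ , inj₁ r′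
            ; (inj₂ s) e → let v , e′ , s′ = zag Q s e in v , e′ , inj₂ s′ }
  }

Span : ∀ {A G H} → Emb A G → Emb A H → Relation G H
Span {A} e f u v = Σ (V A) λ a → fun e a ≡ u × fun f a ≡ v

span : ∀ {A G H} (e : Emb A G) (f : Emb A H) → PartialIso G H (Span e f)
span e f = record
  { functional = λ { (_ , refl , refl) (_ , eq , refl) → cong (fun f) (sym (inj e eq)) }
  ; injective  = λ { (_ , refl , refl) (_ , refl , eq) → cong (fun e) (sym (inj f eq)) }
  ; zig = λ { (_ , refl , refl) d → let a , d′ , eq = back e d in fun f a , forth f d′ , a , eq , refl }
  ; zag = λ { (_ , refl , refl) d → let a , d′ , eq = back f d in fun e a , forth e d′ , a , refl , eq }
  }

record FG (G H : Digraph) (R : Relation G H) : Set where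
  field
    gens      : List (V G × V H)
    gens-in   : All (λ g → R (proj₁ g) (proj₂ g)) gens
    generated : ∀ {u v} → R u v → Any (λ g → Path G (proj₁ g) u) gens
open FG public

FG-union : ∀ {G H R S} → FG G H R → FG G H S → FG G H (R ∪ S)
FG-union F F′ = record
  { gens      = gens F ++ gens F′
  ; gens-in   = Allₚ.++⁺ (All.map inj₁ (gens-in F)) (All.map inj₂ (gens-in F′))
  ; generated = λ { (inj₁ r) → Anyₚ.++⁺ˡ (generated F r)
                  ; (inj₂ s) → Anyₚ.++⁺ʳ (gens F) (generated F′ s) }
  }

-- `FG` speaks of the domain only. A path from a generator is carried over by `zig*`, and
-- `functional` identifies its end, so the partners of the generators generate the codomain.
FG-converse : ∀ {G H R} → PartialIso G H R → FG G H R → FG H G (flip R)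
FG-converse {G} {H} {R} P F = record
  { gens      = map swap (gens F)
  ; gens-in   = Allₚ.map⁺ (gens-in F)
  ; generated = λ r → Anyₚ.map⁺ (transfer r (gens-in F) (generated F r))
  }
  where
  transfer : ∀ {u v L} → R u v → All (λ g → R (proj₁ g) (proj₂ g)) L →
             Any (λ g → Path G (proj₁ g) u) L → Any (λ g → Path H (proj₂ g) v) L
  transfer r (s ∷ _) (here p) with zig* P s p
  ... | _ , p′ , r′ with functional P r r′
  ...   | refl = here p′
  transfer r (_ ∷ ss) (there i) = there (transfer r ss i)

Dom-closed : ∀ {G H R u v} → PartialIso G H R → Dom R u → Path G u v → Dom R v
Dom-closed P (_ , r) p = let v′ , _ , r′ = zig* P r p in v′ , r′

Descendants : (G : Digraph) → List (V G) → V G → Set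
Descendants G X v = Any (λ x → Path G x v) X

idOn : (G : Digraph) → List (V G) → Relation G G
idOn G X u v = u ≡ v × Descendants G X u

partialIso-idOn : (G : Digraph) (X : List (V G)) → PartialIso G G (idOn G X)
partialIso-idOn G X = record
  { functional = λ { (refl , _) (refl , _) → refl }
  ; injective  = λ { (refl , _) (refl , _) → refl }
  ; zig = λ { (refl , d) e → _ , e , refl , Any.map (_◅◅ (e ◅ ε)) d }
  ; zag = λ { (refl , d) e → _ , e , refl , Any.map (_◅◅ (e ◅ ε)) d }
  }

FG-idOn : (G : Digraph) (X : List (V G)) → FG G G (idOn G X)
FG-idOn G X = record
  { gens      = map (λ x → x , x) X
  ; gens-in   = Allₚ.map⁺ (All.tabulate λ x∈X → refl , Any.map (λ { refl → ε }) x∈X)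
  ; generated = λ { (refl , d) → Anyₚ.map⁺ d }
  }

-- Homogeneity for finitely generated relations.

module Homogeneity (lem : ExcludedMiddle 0ℓ) where

  finGen-Dom : ∀ {G H R} → PartialIso G H R → FG G H R → FinGen G (Dom R)
  finGen-Dom {G} {H} {R} P F =
    (λ a v d p → Dom-closed P d (desc⇒path G p)) ,
    map proj₁ (gens F) ,
    λ v → mk⇔ (λ { (_ , r) → Anyₚ.map⁺ (Any.map (path⇒desc lem G) (generated F r)) })
              (λ d → inDom (gens-in F) (Anyₚ.map⁻ d))
    where
    inDom : ∀ {v L} → All (λ g → R (proj₁ g) (proj₂ g)) L →
            Any (λ g → desc G (proj₁ g) v) L → Dom R v
    inDom (r ∷ _)  (here p)  = Dom-closed P (_ , r) (desc⇒path G p)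
    inDom (_ ∷ rs) (there i) = inDom rs i

  subIso : ∀ {G H R} → PartialIso G H R → SubIso G H (Dom R) (Cod R)
  subIso P = record
    { to       = λ _ → proj₁
    ; to-Q     = λ v p → v , proj₂ p
    ; from     = λ _ → proj₁
    ; from-P   = λ w q → w , proj₂ q
    ; to-irr   = λ { _ (_ , r) (_ , r′) → functional P r r′ }
    ; from-irr = λ { _ (_ , r) (_ , r′) → injective P r r′ }
    ; left     = λ _ _ → refl
    ; right    = λ _ _ → refl
    ; edges    = λ { _ _ (_ , r) (_ , r′) → mk⇔ (edge⇒ P r r′) (edge⇒ (converse P) r r′) }
    }

  -- An `Emb` need not be onto; surjectivity is returned separately because preimages under the
  -- automorphism are taken later.
  extend : ∀ {G R} → DescHomogeneous G → PartialIso G G R → FG G G R →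
           Σ (Emb G G) λ σ → (∀ v → Image σ v) × (∀ {u v} → R u v → fun σ u ≡ v)
  extend {G} {R} hom P F
    with hom _ _ (finGen-Dom P F) (finGen-Dom (converse P) (FG-converse P F)) (subIso P)
  ... | σ , ext = record
    { fun   = λ v → to σ v tt
    ; inj   = λ {u} {v} eq → trans (sym (left σ u tt)) (trans (cong (λ w → from σ w tt) eq) (left σ v tt))
    ; forth = λ e → ⇒ (edges σ _ _ _ _) e
    ; back  = λ {u} {v} e → from σ v tt ,
                ⇐ (edges σ _ _ _ _) (subst (E G (to σ u tt)) (sym (right σ v tt)) e) ,
                right σ v tt
    } , (λ v → from σ v tt , right σ v tt) , λ {u} r → ext u (_ , r)

-- The tree and the cones of vertices.

-- The tree T with words written backwards, so that the children of w are the i ∷ w.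
RTree : ℕ → Digraph
RTree q = record { V = List (Fin q) ; E = λ w v → Σ (Fin q) λ i → v ≡ i ∷ w }

RTree-path⁺ : ∀ {q} x {w} → Path (RTree q) w (x ++ w)
RTree-path⁺ []      = ε
RTree-path⁺ (i ∷ x) = RTree-path⁺ x ◅◅ ((i , refl) ◅ ε)

RTree-path⁻ : ∀ {q w v} → Path (RTree q) w v → ∃ λ x → v ≡ x ++ w
RTree-path⁻ ε = [] , refl
RTree-path⁻ {w = w} ((i , refl) ◅ p) with RTree-path⁻ p
... | x , refl = x ∷ʳ i , sym (Listₚ.++-assoc x (i ∷ []) w)

++-cancel-sameLength : ∀ {A : Set} (x y : List A) {w w′} → length w ≡ length w′ →
                       x ++ w ≡ y ++ w′ → w ≡ w′
++-cancel-sameLength []      []      _  eq = eq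
++-cancel-sameLength []      (j ∷ y) {w} {w′} l eq =
  ⊥-elim (ℕₚ.m≢1+n+m (length w′) (trans (sym l) (trans (cong length eq) (Listₚ.length-++ (j ∷ y)))))
++-cancel-sameLength (i ∷ x) []      {w} {w′} l eq =
  ⊥-elim (ℕₚ.m≢1+n+m (length w) (trans l (trans (cong length (sym eq)) (Listₚ.length-++ (i ∷ x)))))
++-cancel-sameLength (i ∷ x) (j ∷ y) l eq = ++-cancel-sameLength x y l (Listₚ.∷-injectiveʳ eq)

TreeAt : ℕ → (G : Digraph) → V G → Set
TreeAt q G u = Σ (Emb (RTree q) G) λ t → fun t [] ≡ u

Disjoint : (G : Digraph) → V G → V G → Set
Disjoint G u v = ∀ {x} → Path G u x → Path G v x → ⊥

-- A common descendant would be a word with the two suffixes `i ∷ w` and `j ∷ w` of equal length.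
siblings-disjoint : ∀ {q G} (t : Emb (RTree q) G) {i j w} → i ≢ j → Disjoint G (fun t (i ∷ w)) (fun t (j ∷ w))
siblings-disjoint t i≢j p p′ with lift t p | lift t p′
... | a , r , refl | b , r′ , eq′ with inj t eq′ | RTree-path⁻ r | RTree-path⁻ r′
...   | refl | x , eq | y , eq″ = i≢j (Listₚ.∷-injectiveˡ (++-cancel-sameLength x y refl (trans (sym eq) eq″)))

descend : ∀ {q G u} ((t , _) : TreeAt q G u) {v} → Path G u v → Image t v
descend (t , refl) p = let w , _ , eq = lift t p in w , eq

-- A path back to `u` would make the empty word end in a one-letter word.
acyclic : ∀ {q G u v} → TreeAt q G u → E G u v → ¬ Path G v u
acyclic (t , refl) e p with back t e
... | _ , (i , refl) , refl with RTree-path⁻ (path⁻ t p)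
...   | []    , ()
...   | _ ∷ _ , ()

-- Bars.

-- Along every branch from the vertex one eventually enters B or avoids it for
-- good; by König's lemma this is finite generation of B below the vertex.
data Bar (G : Digraph) (B : V G → Set) : V G → Set where
  inside  : ∀ {u} → B u → Bar G B u
  outside : ∀ {u} → (∀ {v} → Path G u v → ¬ B v) → Bar G B u
  below   : ∀ {u} → (∀ {v} → E G u v → Bar G B v) → Bar G B u

bar-weaken : ∀ {G B C u} → (∀ {v} → B v → C v) → (∀ {v} → Path G u v → C v → B v) → Bar G B u → Bar G C u
bar-weaken f g (inside b)  = inside (f b)
bar-weaken f g (outside h) = outside λ p c → h p (g p c)
bar-weaken f g (below h)   = below λ e → bar-weaken f (λ p → g (e ◅ p)) (h e)

-- Both bars are followed down together; once one set is avoided for good, the bar for the other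
-- suffices. This passes from single cones to finitely generated sets.
bar-∪ : ∀ {G B C u} → Bar G B u → Bar G C u → Bar G (λ v → B v ⊎ C v) u
bar-∪ (inside b)  _          = inside (inj₁ b)
bar-∪ (outside f) k          = bar-weaken inj₂ (λ { p (inj₁ b) → ⊥-elim (f p b) ; p (inj₂ c) → c }) k
bar-∪ (below h)  (inside c)  = inside (inj₂ c)
bar-∪ (below h)  (outside g) = bar-weaken inj₁ (λ { p (inj₁ b) → b ; p (inj₂ c) → ⊥-elim (g p c) }) (below h)
bar-∪ (below h)  (below k)   = below λ e → bar-∪ (h e) (k e)

bar-map : ∀ {A G B u} (e : Emb A G) → Bar A (λ v → B (fun e v)) u → Bar G B (fun e u)
bar-map e (inside b)  = inside b
bar-map {B = B} e (outside f) = outside λ p b → let v , p′ , eq = lift e p in f p′ (subst B (sym eq) b)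
bar-map e (below h)   = below λ d → let v , d′ , eq = back e d in subst (Bar _ _) eq (bar-map e (h d′))

bar-comap : ∀ {A G B u} (e : Emb A G) → Bar G B (fun e u) → Bar A (λ v → B (fun e v)) u
bar-comap e (inside b)  = inside b
bar-comap e (outside f) = outside λ p → f (path e p)
bar-comap e (below h)   = below λ d → bar-comap e (h (forth e d))

-- Branches of the tree, exchange of branches, and diagonalisation.

module _ {q : ℕ} where

  Word : Set
  Word = List (Fin q)

  Stream : Set
  Stream = ℕ → Fin q

  -- The newest letter stands in front, as in `RTree`, so this is the node at depth `n` of the
  -- branch `y`.
  prefix : Stream → ℕ → Word
  prefix y zero    = []
  prefix y (suc n) = y n ∷ prefix y n

  segment : Stream → ℕ → ℕ → Word
  segment y n zero    = []
  segment y n (suc k) = y (k + n) ∷ segment y n k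

  segment-++-prefix : ∀ y n k → segment y n k ++ prefix y n ≡ prefix y (k + n)
  segment-++-prefix y n zero    = refl
  segment-++-prefix y n (suc k) = cong (y (k + n) ∷_) (segment-++-prefix y n k)

  length-prefix : ∀ y n → length (prefix y n) ≡ n
  length-prefix y zero    = refl
  length-prefix y (suc n) = cong suc (length-prefix y n)

  length-segment : ∀ y n k → length (segment y n k) ≡ k
  length-segment y n zero    = refl
  length-segment y n (suc k) = cong suc (length-segment y n k)

  prefix-cong : ∀ {y z} n → (∀ {k} → k < n → y k ≡ z k) → prefix y n ≡ prefix z n
  prefix-cong zero    eq = refl
  prefix-cong (suc n) eq rewrite eq (ℕₚ.n<1+n n) = cong (_ ∷_) (prefix-cong n λ k<n → eq (ℕₚ.m<n⇒m<1+n k<n))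

  -- The word w continued by v; positions are counted from the root.
  splice : Stream → Word → Stream
  splice v []      n = v n
  splice v (i ∷ w) n with n ℕₚ.≟ length w
  ... | yes _ = i
  ... | no  _ = splice v w n

  splice-∷ : ∀ v i w {n} → n < length w → splice v (i ∷ w) n ≡ splice v w n
  splice-∷ v i w {n} n<w with n ℕₚ.≟ length w
  ... | yes refl = ⊥-elim (ℕₚ.n≮n _ n<w)
  ... | no  _    = refl

  splice-++ : ∀ v x w {n} → n < length w → splice v (x ++ w) n ≡ splice v w n
  splice-++ v []      w n<w = refl
  splice-++ v (i ∷ x) w n<w = trans (splice-∷ v i (x ++ w) (ℕₚ.≤-trans n<w w≤x++w)) (splice-++ v x w n<w)
    where
    w≤x++w : length w ≤ length (x ++ w)
    w≤x++w = subst (length w ≤_) (sym (Listₚ.length-++ x)) (ℕₚ.m≤n+m (length w) (length x))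

  prefix-splice : ∀ v w → prefix (splice v w) (length w) ≡ w
  prefix-splice v []      = refl
  prefix-splice v (i ∷ w) with length w ℕₚ.≟ length w | prefix-cong (length w) (splice-∷ v i w)
  ... | yes _ | eq = cong (i ∷_) (trans eq (prefix-splice v w))
  ... | no ¬p | _  = ⊥-elim (¬p refl)

  -- Each step adds at least one letter, so `s (suc n)` is longer than `n`, and later words only
  -- prolong it. Letter `n` of the limit is therefore read off from `s (suc n)`.
  limit : (s : ℕ → Word) (x : ℕ → Word) → (∀ i → s (suc i) ≡ x i ++ s i) → (∀ i → 0 < length (x i)) →
          Σ Stream λ y → ∀ i → prefix y (length (s i)) ≡ s i
  limit s x ext pos = y , λ i → trans (prefix-cong _ (agree i)) (prefix-splice v (s i))
    where
    -- An arbitrary continuation; a letter is taken from the first extension because `Fin q` could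
    -- be empty.
    v : Stream
    v with x 0 | pos 0
    ... | a ∷ _ | _ = λ _ → a

    y : Stream
    y n = splice v (s (suc n)) n

    grow : ∀ i → length (s i) < length (s (suc i))
    grow i = subst (λ w → length (s i) < length w) (sym (ext i))
               (subst (length (s i) <_) (sym (Listₚ.length-++ (x i))) (ℕₚ.+-monoˡ-≤ (length (s i)) (pos i)))

    long : ∀ i → i ≤ length (s i)
    long zero    = z≤n
    long (suc i) = ℕₚ.≤-trans (s≤s (long i)) (grow i)

    step : ∀ i {n} → n < length (s i) → splice v (s (suc i)) n ≡ splice v (s i) n
    step i {n} n<s = trans (cong (λ w → splice v w n) (ext i)) (splice-++ v (x i) (s i) n<s)

    steps : ∀ i k {n} → n < length (s i) → n < length (s (k + i)) × splice v (s (k + i)) n ≡ splice v (s i) n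
    steps i zero    n<s = n<s , refl
    steps i (suc k) n<s = let lt , eq = steps i k n<s in
      ℕₚ.<-trans lt (grow (k + i)) , trans (step (k + i) lt) eq

    agree : ∀ i {n} → n < length (s i) → y n ≡ splice v (s i) n
    agree i {n} n<s = trans (sym (proj₂ (steps (suc n) i (long (suc n)))))
      (trans (cong (λ k → splice v (s k) n) (ℕₚ.+-comm i (suc n))) (proj₂ (steps i (suc n) n<s)))

  -- The automorphism of the tree exchanging the branches a and b level by level.
  act : Stream → Stream → Word → Word
  act a b []      = []
  act a b (i ∷ w) = transpose (a (length w)) (b (length w)) i ∷ act a b w

  length-act : ∀ a b w → length (act a b w) ≡ length w
  length-act a b []      = refl
  length-act a b (i ∷ w) = cong suc (length-act a b w)

  act-inverse : ∀ a b w → act a b (act b a w) ≡ w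
  act-inverse a b []      = refl
  act-inverse a b (i ∷ w) rewrite length-act b a w | act-inverse a b w =
    cong (_∷ w) (transpose-inverse (a (length w)) (b (length w)))

  transpose-left : ∀ (i j : Fin q) → transpose i j i ≡ j
  transpose-left i j with i Finₚ.≟ i
  ... | yes _ = refl
  ... | no ¬p = ⊥-elim (¬p refl)

  transpose-right : ∀ (i j : Fin q) → transpose i j j ≡ i
  transpose-right i j with j Finₚ.≟ i
  ... | yes j≡i = j≡i
  ... | no _ with j Finₚ.≟ j
  ...   | yes _ = refl
  ...   | no ¬p = ⊥-elim (¬p refl)

  length-segment-++ : ∀ y {n} k {p} → length p ≡ n → length (segment y n k ++ p) ≡ k + n
  length-segment-++ y zero    eq = eq
  length-segment-++ y (suc k) eq = cong suc (length-segment-++ y k eq)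

  act-segment : ∀ a b {n} k {p} → length p ≡ n → act a b (segment b n k ++ p) ≡ segment a n k ++ act a b p
  act-segment a b zero    eq = refl
  act-segment a b {n} (suc k) eq = cong₂ _∷_
    (trans (cong (λ m → transpose (a m) (b m) (b (k + n))) (length-segment-++ b k eq))
           (transpose-right (a (k + n)) (b (k + n))))
    (act-segment a b k eq)

  act-prefix : ∀ a b n → act a b (prefix a n) ≡ prefix b n
  act-prefix a b zero = refl
  act-prefix a b (suc n) rewrite length-prefix a n =
    cong₂ _∷_ (transpose-left (a n) (b n)) (act-prefix a b n)

  actEmb : Stream → Stream → Emb (RTree q) (RTree q)
  actEmb a b = record
    { fun   = act a b
    ; inj   = λ {u} {v} eq → trans (sym (act-inverse b a u)) (trans (cong (act b a) eq) (act-inverse b a v))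
    ; forth = λ { (i , refl) → _ , refl }
    ; back  = λ { {u} (i , refl) → let j = transpose (b (length u)) (a (length u)) i in
                 j ∷ u , (j , refl) , cong (_∷ act a b u) (transpose-inverse (a (length u)) (b (length u))) }
    }

  -- If B is not barred, its complement contains a branch v below which B is met infinitely
  -- often; y is chosen so that the preimage of B under act y v differs from every C i.
  module Diagonal (lem : ExcludedMiddle 0ℓ) (B : Word → Set) (C : ℕ → Word → Set)
                  (closed : ∀ {w i} → B w → B (i ∷ w)) (unbarred : ¬ Bar (RTree q) B []) where

    Unbarred : Word → Set
    Unbarred w = ¬ Bar (RTree q) B w

    unbarred-child : ∀ {w} → Unbarred w → ∃ λ i → Unbarred (i ∷ w)
    unbarred-child nb = Finₚ.¬∀⟶∃¬ q _ (λ _ → lem) λ all → nb (below λ { (i , refl) → all i })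

    unbarred-meets : ∀ {w} → Unbarred w → ∃ λ x → B (x ++ w)
    unbarred-meets {w} nb with lem {P = ∃ λ x → B (x ++ w)}
    ... | yes b  = b
    ... | no ¬b = ⊥-elim (nb (outside λ p b → let x , eq = RTree-path⁻ p in ¬b (x , subst B eq b)))

    node : ℕ → Σ Word Unbarred
    node zero    = [] , unbarred
    node (suc n) = let w , nb = node n ; i , nb′ = unbarred-child nb in i ∷ w , nb′

    v : Stream
    v n = proj₁ (unbarred-child (proj₂ (node n)))

    prefix-v : ∀ n → prefix v n ≡ proj₁ (node n)
    prefix-v zero    = refl
    prefix-v (suc n) = cong (v n ∷_) (prefix-v n)

    v∉B : ∀ n → ¬ B (prefix v n)
    v∉B n b = proj₂ (node n) (inside (subst B (prefix-v n) b))

    -- `x` is nonempty because the branch `v` avoids `B`; `limit` relies on this growth.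
    meets : ∀ n → ∃ λ x → 0 < length x × B (x ++ prefix v n)
    meets n with subst (λ w → ∃ λ x → B (x ++ w)) (sym (prefix-v n)) (unbarred-meets (proj₂ (node n)))
    ... | []    , b = ⊥-elim (v∉B n b)
    ... | i ∷ x , b = i ∷ x , s≤s z≤n , b

    -- With `p` already a prefix of `y`, the word `test` follows `v` after `p`. If `C i` holds
    -- there, `y` is led through `test`, whose image under `act y v` lies on `v`, outside `B`.
    -- Otherwise `y` continues by `x`, and the exchange sends `test` to `x ++ prefix v (length p)`,
    -- which lies in `B`. Either way the preimage of `B` and `C i` differ at `test`.
    module Stage (i : ℕ) (p : Word) where
      x : Word
      x = proj₁ (meets (length p))

      x-pos : 0 < length x
      x-pos = proj₁ (proj₂ (meets (length p)))

      x-hits : B (x ++ prefix v (length p))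
      x-hits = proj₂ (proj₂ (meets (length p)))

      v-part : Word
      v-part = segment v (length p) (length x)

      test : Word
      test = v-part ++ p

      choice : Σ Word λ e → 0 < length e × ((e ≡ v-part × C i test) ⊎ (e ≡ x × ¬ C i test))
      choice with lem {P = C i test}
      ... | yes c = v-part , subst (0 <_) (sym (length-segment v (length p) (length x))) x-pos , inj₁ (refl , c)
      ... | no ¬c = x , x-pos , inj₂ (refl , ¬c)

      separates : ∀ y → prefix y (length p) ≡ p →
                  prefix y (length (proj₁ choice ++ p)) ≡ proj₁ choice ++ p →
                  ¬ (B (act y v test) ⇔ C i test)
      separates y y-p y-e iff with choice
      ... | _ , _ , inj₁ (refl , c) = v∉B _ (subst B (trans (cong (act y v) (sym y-e)) (act-prefix y v _)) (⇐ iff c))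
      ... | _ , _ , inj₂ (refl , ¬c) = ¬c (⇒ iff (subst B (sym image) x-hits))
        where
        n = length p
        y-x : segment y n (length x) ≡ x
        y-x = Listₚ.++-cancelʳ (prefix y n) _ _ (trans (segment-++-prefix y n (length x))
                (trans (cong (prefix y) (sym (Listₚ.length-++ x))) (trans y-e (cong (x ++_) (sym y-p)))))
        image : act y v test ≡ x ++ prefix v n
        image = trans (act-segment y v (length x) refl)
                  (cong₂ _++_ y-x (trans (cong (act y v) (sym y-p)) (act-prefix y v n)))

    stage : ℕ → Word
    stage zero    = []
    stage (suc i) = proj₁ (Stage.choice i (stage i)) ++ stage i

    diagonal : Σ Stream λ y → ∀ i → ∃ λ u → ¬ (B (act y v u) ⇔ C i u)
    diagonal =
      let y , through = limit stage (λ i → proj₁ (Stage.choice i (stage i))) (λ _ → refl)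
                                    (λ i → proj₁ (proj₂ (Stage.choice i (stage i))))
      in y , λ i → Stage.test i (stage i) , Stage.separates i (stage i) y (through i) (through (suc i))

-- The digraphs to be compared, and decompositions of their cones.

record Good (q : ℕ) (G : Digraph) : Set₁ where
  field
    countable   : Countable G
    homogeneous : DescHomogeneous G
    trees       : ∀ u → TreeAt q G u
    vertex      : V G
open Good public

disjoint-≤ : ∀ {G u v v′} → Path G v v′ → Disjoint G u v → Disjoint G u v′
disjoint-≤ p d q r = d q (p ◅◅ r)

idᴱ : ∀ {G} → Emb G G
idᴱ = record { fun = λ u → u ; inj = λ eq → eq ; forth = λ e → e ; back = λ e → _ , e , refl }

root-path : ∀ {q G u} ((t , _) : TreeAt q G u) w → Path G u (fun t w)
root-path (t , refl) w = subst (λ v → Path _ _ (fun t v)) (Listₚ.++-identityʳ w) (path t (RTree-path⁺ w))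

FG-cones : ∀ {q G H u v} ((s , _) : TreeAt q G u) ((t , _) : TreeAt q H v) → FG G H (Span s t)
FG-cones {u = u} {v} S@(s , s[]) T@(t , t[]) = record
  { gens      = (u , v) ∷ []
  ; gens-in   = ([] , s[] , t[]) ∷ []
  ; generated = λ { (w , refl , refl) → here (root-path S w) }
  }

-- Words branching off the path from the root to w: together with w, their cones
-- cover the tree except for the proper ancestors of w.
offPath : ∀ {n} → List (Fin (suc n)) → List (List (Fin (suc n)))
offPath []      = []
offPath (i ∷ w) = map (λ j → punchIn i j ∷ w) (allFin _) ++ offPath w

offPath-disjoint : ∀ {n} (w : List (Fin (suc n))) → All (λ v → Disjoint (RTree (suc n)) v w) (offPath w)
offPath-disjoint []      = []
offPath-disjoint {n} (i ∷ w) = Allₚ.++⁺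
  (Allₚ.map⁺ (All.tabulate λ {j} _ → siblings-disjoint idᴱ (Finₚ.punchInᵢ≢i i j)))
  (All.map (λ {v} → disjoint-≤ {RTree (suc n)} {v} ((i , refl) ◅ ε)) (offPath-disjoint w))

offPath-cover : ∀ {n} (w e : List (Fin (suc n))) →
  Any (λ v → Path (RTree (suc n)) v e) (offPath w) ⊎ Path (RTree (suc n)) w e ⊎ Path (RTree (suc n)) e w
offPath-cover []      e = inj₂ (inj₁ (subst (Path _ _) (Listₚ.++-identityʳ e) (RTree-path⁺ e)))
offPath-cover (i ∷ w) e with offPath-cover w e
... | inj₁ a        = inj₁ (Anyₚ.++⁺ʳ (map (λ j → punchIn i j ∷ w) (allFin _)) a)
... | inj₂ (inj₂ p) = inj₂ (inj₂ (p ◅◅ ((i , refl) ◅ ε)))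
... | inj₂ (inj₁ ε) = inj₂ (inj₂ ((i , refl) ◅ ε))
... | inj₂ (inj₁ ((j , refl) ◅ p)) with i Finₚ.≟ j
...   | yes refl = inj₂ (inj₁ p)
...   | no i≢j   = inj₁ (Anyₚ.++⁺ˡ (Anyₚ.map⁺ (lose (∈-allFin (punchOut i≢j))
                     (subst (λ k → Path _ (k ∷ w) e) (sym (Finₚ.punchIn-punchOut i≢j)) p))))

-- Free cones and finitely generated intersections.

module Extension (lem : ExcludedMiddle 0ℓ) (r : ℕ) where
  open Homogeneity lem

  q : ℕ
  q = suc (suc r)

  module _ {G : Digraph} (good : Good q G) where

    Free : List (V G) → V G → Set
    Free X c = ∀ {v} → Path G c v → ¬ Descendants G X v

    treeEmb : ∀ u → Emb (RTree q) G
    treeEmb u = proj₁ (trees good u)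

    -- An automorphism that fixes desc X and the rest of desc b below the level of c, and
    -- shrinks the cone of c to that of a child c₀, leaves room at the sibling c₁ of c₀.
    room-step : ∀ b {c} X → Free X c → Path G b c → ∃ (Free (b ∷ X))
    room-step b {c} X free b⇝c with trees good b
    ... | t , refl with descend (t , refl) b⇝c
    ...   | w , refl = e , e-free
      where
      S : List (V G)
      S = X ++ map (fun t) (offPath w)

      free-S : Free S c
      free-S p d with Anyₚ.++⁻ X d
      ... | inj₁ a = free p a
      ... | inj₂ a = clash (offPath-disjoint w) (Anyₚ.map⁻ a)
        where
        clash : ∀ {L} → All (λ v → Disjoint (RTree q) v w) L → Any (λ v → Path G (fun t v) _) L → ⊥
        clash (d ∷ _) (here p′) with lift t p | lift t p′
        ... | _ , l , refl | _ , l′ , eq with inj t eq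
        ...   | refl = d l′ l
        clash (_ ∷ ds) (there a) = clash ds a

      c₀ c₁ : V G
      c₀ = fun t (zero ∷ w)
      c₁ = fun t (suc zero ∷ w)

      c⇝c₀ : Path G c c₀
      c⇝c₀ = forth t (zero , refl) ◅ ε

      c⇝c₁ : Path G c c₁
      c⇝c₁ = forth t (suc zero , refl) ◅ ε

      R : Relation G G
      R = idOn G S ∪ Span (treeEmb c) (treeEmb c₀)

      R-iso : PartialIso G G R
      R-iso = union (partialIso-idOn G S) (span (treeEmb c) (treeEmb c₀))
        (λ { (refl , d) (x , refl , _) → ⊥-elim (free-S (root-path (trees good c) x) d) })
        (λ { (refl , d) (x , _ , refl) → ⊥-elim (free-S (c⇝c₀ ◅◅ root-path (trees good c₀) x) d) })

      extension : Σ (Emb G G) λ σ → (∀ v → Image σ v) × (∀ {u v} → R u v → fun σ u ≡ v)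
      extension = extend (homogeneous good) R-iso (FG-union (FG-idOn G S) (FG-cones (trees good c) (trees good c₀)))

      σ : Emb G G
      σ = proj₁ extension

      σ-extends : ∀ {u v} → R u v → fun σ u ≡ v
      σ-extends = proj₂ (proj₂ extension)

      e : V G
      -- `σ` fixes the descendants of `S` and maps the cone of `c` onto that of `c₀`. The cone of
      -- `c₁` meets neither image, so that of its preimage meets neither source.
      e = proj₁ (proj₁ (proj₂ extension) c₁)

      image-in : ∀ {v} → Path G e v → Path G c₁ (fun σ v)
      image-in {v} p = subst (λ u → Path G u (fun σ v)) (proj₂ (proj₁ (proj₂ extension) c₁)) (path σ p)

      not-S : ∀ {v} → Path G e v → ¬ Descendants G S v
      not-S p d = free-S (c⇝c₁ ◅◅ subst (Path G c₁) (σ-extends (inj₁ (refl , d))) (image-in p)) d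

      not-c : ∀ {v} → Path G e v → ¬ Path G c v
      not-c p p′ with descend (trees good c) p′
      ... | x , refl = siblings-disjoint t (λ ()) (subst (Path G c₁) (σ-extends (inj₂ (x , refl , refl))) (image-in p))
                                                   (root-path (trees good c₀) x)

      e-free : Free (b ∷ X) e
      e-free p (there d) = not-S p (Anyₚ.++⁺ˡ d)
      -- A descendant of `b` lies in a branch listed in `S`, in the cone of `c`, or above `c`; in
      -- the last case `c` itself would lie below `e`.
      e-free p (here d) with descend (t , refl) d
      ... | x , refl with offPath-cover w x
      ...   | inj₁ a         = not-S p (Anyₚ.++⁺ʳ X (Anyₚ.map⁺ (Any.map (path t) a)))
      ...   | inj₂ (inj₁ p′) = not-c p (path t p′)
      ...   | inj₂ (inj₂ p′) = not-c (p ◅◅ path t p′) ε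

    -- If the cone free from `X` meets that of `b`, a common vertex is still free from `X` and lies
    -- below `b`, which is the situation of `room-step`.
    room : ∀ X → ∃ (Free X)
    room [] = vertex good , λ _ ()
    room (b ∷ X) with room X
    ... | c , free with lem {P = ∃ λ v → Path G c v × Path G b v}
    ...   | no ¬meet          = c , λ { p (here d) → ¬meet (_ , p , d) ; p (there d) → free p d }
    ...   | yes (v , p , p′) = room-step b X (λ p″ → free (p ◅◅ p″)) p′

    -- Automorphisms of the tree at a extend to D, so desc a ∩ desc b has only countably
    -- many images under them; an unbarred set would have uncountably many.
    bars : ∀ a b → Bar G (Path G b) a
    bars a b with trees good a
    ... | t , refl with lem {P = Bar (RTree q) (λ w → Path G b (fun t w)) []}
    ...   | yes bar = bar-map t bar
    ...   | no ¬bar = ⊥-elim (differs y-differs)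
      where
      code : V G → ℕ
      code = proj₁ (countable good)

      -- `C i` is the trace on the tree of the cone of the vertex with code `i`, and is empty if no
      -- vertex has that code.
      open Diagonal lem (λ w → Path G b (fun t w)) (λ i u → ∃ λ b′ → code b′ ≡ i × Path G b′ (fun t u))
                    (λ p → p ◅◅ (forth t (_ , refl) ◅ ε)) ¬bar

      y : Stream
      y = proj₁ diagonal

      extension : Σ (Emb G G) λ σ → (∀ z → Image σ z) × (∀ {u u′} → Span t (t ∘ᴱ actEmb v y) u u′ → fun σ u ≡ u′)
      extension = extend (homogeneous good) (span t (t ∘ᴱ actEmb v y)) (FG-cones (t , refl) (t ∘ᴱ actEmb v y , refl))

      σ : Emb G G
      σ = proj₁ extension

      σ-act : ∀ u → fun σ (fun t (act y v u)) ≡ fun t u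
      σ-act u = trans (proj₂ (proj₂ extension) (act y v u , refl , refl)) (cong (fun t) (act-inverse v y u))

      y-differs : ∃ λ u → ¬ (Path G b (fun t (act y v u)) ⇔ ∃ λ b′ → code b′ ≡ code (fun σ b) × Path G b′ (fun t u))
      y-differs = proj₂ diagonal (code (fun σ b))

      differs : ¬ (∃ λ u → ¬ (Path G b (fun t (act y v u)) ⇔ ∃ λ b′ → code b′ ≡ code (fun σ b) × Path G b′ (fun t u)))
      -- `σ` turns the preimage of the cone of `b` under the exchange into the trace of the cone of
      -- `fun σ b`; injectivity of the code makes `b′` equal to `fun σ b`, contradicting the choice
      -- of `y`.
      differs (u , ¬iff) = ¬iff (mk⇔
        (λ p → fun σ b , refl , subst (Path G (fun σ b)) (σ-act u) (path σ p))
        (λ { (b′ , eq , p) → path⁻ σ (subst (Path G (fun σ b)) (sym (σ-act u))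
                                        (subst (λ z → Path G z (fun t u)) (proj₂ (countable good) eq) p)) }))

    bars-descendants : ∀ X a → Bar G (Descendants G X) a
    bars-descendants []      a = outside λ _ ()
    bars-descendants (b ∷ X) a = bar-weaken (λ { (inj₁ p) → here p ; (inj₂ d) → there d })
                                            (λ { _ (here p) → inj₁ p ; _ (there d) → inj₂ d })
                                            (bar-∪ (bars a b) (bars-descendants X a))

  -- Common parents of independent vertices.

  -- This is `𝒯 q m` without its `m` new vertices: `q` disjoint copies of the tree.
  Forest : Digraph
  Forest = record { V = Fin q × Word {q} ; E = λ { (i , w) (j , v) → j ≡ i × ∃ λ k → v ≡ k ∷ w } }

  Spread : (G : Digraph) → (Fin q → V G) → Set
  Spread G c = ∀ {i j} → i ≢ j → Disjoint G (c i) (c j)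

  IsParent : (G : Digraph) → (Fin q → V G) → V G → Set
  IsParent G c p = (∀ i → E G p (c i)) × (∀ {v} → E G p v → ∃ λ i → c i ≡ v)

  Parents : (G : Digraph) → (Fin q → V G) → ℕ → Set
  Parents G c m = Σ (Fin m → V G) λ p → (∀ {x y} → p x ≡ p y → x ≡ y) × (∀ x → IsParent G c (p x))

  forest𝒯 : ∀ m → Emb Forest (𝒯 q m)
  forest𝒯 m = record
    { fun   = λ { (i , w) → old i (reverse w) }
    ; inj   = λ { {i , w} {j , v} eq → old-inj eq }
    ; forth = λ { {i , w} (refl , k , refl) → subst (TnEdge q m _ ∘ old i) (sym (Listₚ.unfold-reverse k w)) (oldE i (reverse w) k) }
    ; back  = λ { {i , w} (oldE _ _ k) → (i , k ∷ w) , (refl , k , refl) , cong (old i) (Listₚ.unfold-reverse k w) }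
    }
    where
    old-inj : ∀ {i j w v} → old {q} {m} i (reverse w) ≡ old j (reverse v) → (i , w) ≡ (j , v)
    old-inj {w = w} {v} eq with reverse w in eqw | reverse v in eqv
    old-inj refl | _ | _ = cong (_ ,_) (Listₚ.reverse-injective (trans eqw (sym eqv)))

  module _ {G : Digraph} (good : Good q G) {c : Fin q → V G} (spread : Spread G c) where

    private
      t : ∀ i → Emb (RTree q) G
      t i = treeEmb good (c i)

      t-root : ∀ i → fun (t i) [] ≡ c i
      t-root i = proj₂ (trees good (c i))

      c⇝t : ∀ i w → Path G (c i) (fun (t i) w)
      c⇝t i = root-path (trees good (c i))

    forest : Emb Forest G
    forest = record
      { fun   = λ { (i , w) → fun (t i) w }
      ; inj   = inj′
      ; forth = λ { {i , w} (refl , k , refl) → forth (t i) (k , refl) }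
      ; back  = λ { {i , w} e → back′ i w e }
      }
      where
      inj′ : ∀ {u v} → fun (t (proj₁ u)) (proj₂ u) ≡ fun (t (proj₁ v)) (proj₂ v) → u ≡ v
      inj′ {i , w} {j , v} eq with i Finₚ.≟ j
      ... | yes refl = cong (i ,_) (inj (t i) eq)
      ... | no i≢j   = ⊥-elim (spread i≢j (c⇝t i w) (subst (Path G (c j)) (sym eq) (c⇝t j v)))

      back′ : ∀ i w {v} → E G (fun (t i) w) v →
              ∃ λ u → E Forest (i , w) u × fun (t (proj₁ u)) (proj₂ u) ≡ v
      back′ i w e with back (t i) e
      ... | _ , (k , refl) , eq = (i , k ∷ w) , (refl , k , refl) , eq

    -- The parents serve as the new vertices over the cones of the `c i`; acyclicity keeps them out
    -- of these cones.
    parents⇒emb : ∀ {m} → Parents G c m → Emb (𝒯 q m) G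
    parents⇒emb {m} (p , p-inj , isParent) = record { fun = f ; inj = f-inj ; forth = f-forth ; back = f-back }
      where
      f : TnV q m → V G
      f (old i w) = fun (t i) (reverse w)
      f (new x)   = p x

      new≢old : ∀ {x i} w → p x ≢ fun (t i) w
      new≢old {x} {i} w eq = acyclic (trees good (p x)) (proj₁ (isParent x) i) (subst (Path G (c i)) (sym eq) (c⇝t i w))

      f-inj : ∀ {u v} → f u ≡ f v → u ≡ v
      f-inj {old i w} {old j v} eq with inj forest {i , reverse w} {j , reverse v} eq | Listₚ.reverse-injective {x = w} {y = v}
      ... | eq′ | rev-inj with cong proj₁ eq′ | rev-inj (cong proj₂ eq′)
      ...   | refl | refl = refl
      f-inj {old i w} {new x}   eq = ⊥-elim (new≢old (reverse w) (sym eq))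
      f-inj {new x}   {old j v} eq = ⊥-elim (new≢old (reverse v) eq)
      f-inj {new x}   {new y}   eq = cong new (p-inj eq)

      f-forth : ∀ {u v} → TnEdge q m u v → E G (f u) (f v)
      f-forth (oldE i w k) = forth (t i) (k , Listₚ.reverse-++ w (k ∷ []))
      f-forth (newE x i)   = subst (E G (p x)) (sym (t-root i)) (proj₁ (isParent x) i)

      f-back : ∀ {u v} → E G (f u) v → ∃ λ u′ → TnEdge q m u u′ × f u′ ≡ v
      f-back {old i w} e with back (t i) e
      ... | _ , (k , refl) , eq = old i (w ∷ʳ k) , oldE i w k , trans (cong (fun (t i)) (Listₚ.reverse-++ w (k ∷ []))) eq
      f-back {new x} e with proj₂ (isParent x) e
      ... | i , eq = old i [] , newE x i , trans (t-root i) eq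

    -- By homogeneity an automorphism carries the forest inside the copy of `𝒯 q m` to the cones of
    -- the given tuple, and the new vertices to parents of it. So whether `m` parents exist does not
    -- depend on the spread tuple.
    emb⇒parents : ∀ {m} → Emb (𝒯 q m) G → Parents G c m
    emb⇒parents {m} e = (λ x → fun σe (new x)) , (λ eq → new-inj (inj σe eq)) , λ x →
      (λ i → subst (E G (fun σe (new x))) (at-c i) (forth σe (newE x i))) , λ d → child-c (back σe d)
      where
      new-inj : ∀ {x y} → new {q} {m} x ≡ new y → x ≡ y
      new-inj refl = refl

      R : Relation G G
      R = Span (e ∘ᴱ forest𝒯 m) forest

      FG-R : FG G G R
      FG-R = record
        { gens      = map (λ i → fun e (old i []) , c i) (allFin q)
        ; gens-in   = Allₚ.map⁺ (All.tabulate λ {i} _ → (i , []) , refl , t-root i)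
        ; generated = λ { ((i , w) , refl , _) → Anyₚ.map⁺ (lose (∈-allFin i)
                          (path (e ∘ᴱ forest𝒯 m) {i , []} {i , w} (forest-path i w))) }
        }
        where
        forest-path : ∀ i w → Path Forest (i , []) (i , w)
        forest-path i []      = ε
        forest-path i (k ∷ w) = forest-path i w ◅◅ ((refl , k , refl) ◅ ε)

      extension : Σ (Emb G G) λ σ → (∀ v → Image σ v) × (∀ {u v} → R u v → fun σ u ≡ v)
      extension = extend (homogeneous good) (span (e ∘ᴱ forest𝒯 m) forest) FG-R

      σe : Emb (𝒯 q m) G
      σe = proj₁ extension ∘ᴱ e

      at-c : ∀ i → fun σe (old i []) ≡ c i
      at-c i = proj₂ (proj₂ extension) ((i , []) , refl , t-root i)

      child-c : ∀ {x v} → (∃ λ u → TnEdge q m (new x) u × fun σe u ≡ v) → ∃ λ i → c i ≡ v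
      child-c (_ , newE x i , eq) = i , trans (sym (at-c i)) eq

  -- A vertex has at most one parent of a given tuple below it, since its descendants form a tree.
  parents-bounded : ∀ {G} → Good q G → {c : Fin q → V G} (X : List (V G)) {m : ℕ} ((p , _) : Parents G c m) →
                    (∀ x → Descendants G X (p x)) → m ≤ length X
  parents-bounded {G} good {c} X {m} (p , p-inj , isParent) below-X = ℕₚ.≮⇒≥ λ X<m →
    let x , y , x<y , eq = Finₚ.pigeonhole X<m (λ x → Any.index (below-X x))
    in Finₚ.<⇒≢ x<y (p-inj (unique (isParent x) (isParent y)
         (Anyₚ.lookup-index (below-X x))
         (subst (λ k → Path G (lookup X k) (p y)) (sym eq) (Anyₚ.lookup-index (below-X y)))))
    where
    unique : ∀ {z u v} → IsParent G c u → IsParent G c v → Path G z u → Path G z v → u ≡ v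
    unique {z} (u→c , _) (v→c , _) z⇝u z⇝v with descend (trees good z) z⇝u | descend (trees good z) z⇝v
    ... | w , refl | w′ , refl with back (treeEmb good z) (u→c zero) | back (treeEmb good z) (v→c zero)
    ...   | _ , (i , refl) , eq | _ , (j , refl) , eq′ =
      cong (fun (treeEmb good z)) (Listₚ.∷-injectiveʳ (inj (treeEmb good z) (trans eq (sym eq′))))

  -- Extending a partial isomorphism by one vertex.

  -- `bound` locates the added part of the domain, so that an extension on one cone leaves disjoint
  -- cones untouched.
  record Extends (G H : Digraph) (R : Relation G H) (New : V G → Set) : Set₁ where
    field
      rel    : Relation G H
      iso    : PartialIso G H rel
      fg     : FG G H rel
      extends : ∀ {u v} → R u v → rel u v
      bound   : ∀ {u} → Dom rel u → Dom R u ⊎ New u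

  module _ {G H : Digraph} (goodG : Good q G) (goodH : Good q H)
           (spec : ∀ {m} → Emb (𝒯 q m) G → Emb (𝒯 q m) H) where
    open Extends

    module _ {R : Relation G H} (P : PartialIso G H R) (F : FG G H R)
             {w : V G} {c : Fin q → V G} (spread : Spread G c) (w-parent : IsParent G c w) (w∉R : ¬ Dom R w)
             {c′ : Fin q → V H} (c~c′ : ∀ i → R (c i) (c′ i)) where

      private
        spread′ : Spread H c′
        spread′ i≢j p p′ with zig* (converse P) (c~c′ _) p | zig* (converse P) (c~c′ _) p′
        ... | _ , s , r | _ , s′ , r′ with injective P r r′
        ...   | refl = spread i≢j s s′

        pull : ∀ {u p} → R u p → IsParent H c′ p → IsParent G c u
        pull {u} {p} r (p→c′ , children) = to-c , from-c
          where
          to-c : ∀ i → E G u (c i)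
          to-c i with zag P r (p→c′ i)
          ... | _ , e , r′ with injective P r′ (c~c′ i)
          ...   | refl = e
          from-c : ∀ {v} → E G u v → ∃ λ i → c i ≡ v
          from-c e with zig P r e
          ... | _ , e′ , r′ with children e′
          ...   | i , refl = i , injective P (c~c′ i) r′

      -- If every parent of c′ were in the codomain, then w would always provide one more
      -- parent of c than there are of c′, so c′ would have infinitely many parents.
      fresh-parent : ∃ λ p → IsParent H c′ p × ¬ Cod R p
      fresh-parent with lem {P = ∃ λ p → IsParent H c′ p × ¬ Cod R p}
      ... | yes p = p
      -- All parents lie below the generators of the codomain, so `parents-bounded` is contradicted
      -- by `many` at one more than the number of these generators.
      ... | no ¬p = ⊥-elim (ℕₚ.1+n≰n (parents-bounded goodH gens′ (many _) λ x →
                      Anyₚ.map⁺ (generated (FG-converse P F) (proj₂ (covered (proj₂ (proj₂ (many _)) x))))))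
        where
        gens′ : List (V H)
        gens′ = map proj₁ (gens (FG-converse P F))

        covered : ∀ {p} → IsParent H c′ p → Cod R p
        covered {p} isParent with lem {P = Cod R p}
        ... | yes r = r
        ... | no ¬r = ⊥-elim (¬p (p , isParent , ¬r))

        many : ∀ m → Parents H c′ m
        many zero = (λ ()) , (λ { {()} }) , λ ()
        many (suc m) = emb⇒parents goodH spread′ (spec (parents⇒emb goodG spread (p , p-inj , isParent)))
          where
          ps = many m
          cov : ∀ x → Cod R (proj₁ ps x)
          cov x = covered (proj₂ (proj₂ ps) x)
          p : Fin (suc m) → V G
          p zero    = w
          p (suc x) = proj₁ (cov x)
          p-inj : ∀ {x y} → p x ≡ p y → x ≡ y
          p-inj {zero}  {zero}  eq = refl
          p-inj {zero}  {suc y} eq = ⊥-elim (w∉R (_ , subst (λ u → R u (proj₁ ps y)) (sym eq) (proj₂ (cov y))))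
          p-inj {suc x} {zero}  eq = ⊥-elim (w∉R (_ , subst (λ u → R u (proj₁ ps x)) eq (proj₂ (cov x))))
          p-inj {suc x} {suc y} eq = cong suc (proj₁ (proj₂ ps)
            (functional P (proj₂ (cov x)) (subst (λ u → R u (proj₁ ps y)) (sym eq) (proj₂ (cov y)))))
          isParent : ∀ x → IsParent G c (p x)
          isParent zero    = w-parent
          isParent (suc x) = pull (proj₂ (cov x)) (proj₂ (proj₂ ps) x)

      add-parent : Σ (Extends G H R (w ≡_)) λ X → Dom (rel X) w
      add-parent = let p , (p→c′ , children) , p∉R = fresh-parent in record
        { rel = λ u v → R u v ⊎ (u ≡ w × v ≡ p)
        ; iso = record
          { functional = λ { (inj₁ r) (inj₁ r′) → functional P r r′
                           ; (inj₁ r) (inj₂ (refl , _)) → ⊥-elim (w∉R (_ , r))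
                           ; (inj₂ (refl , _)) (inj₁ r) → ⊥-elim (w∉R (_ , r))
                           ; (inj₂ (_ , refl)) (inj₂ (_ , refl)) → refl }
          ; injective  = λ { (inj₁ r) (inj₁ r′) → injective P r r′
                           ; (inj₁ r) (inj₂ (_ , refl)) → ⊥-elim (p∉R (_ , r))
                           ; (inj₂ (_ , refl)) (inj₁ r) → ⊥-elim (p∉R (_ , r))
                           ; (inj₂ (refl , _)) (inj₂ (refl , _)) → refl }
          ; zig = λ { (inj₁ r) e → let v , e′ , r′ = zig P r e in v , e′ , inj₁ r′
                    ; (inj₂ (refl , refl)) e → let i , eq = proj₂ w-parent e in
                        c′ i , p→c′ i , inj₁ (subst (λ u → R u (c′ i)) eq (c~c′ i)) }
          ; zag = λ { (inj₁ r) e → let v , e′ , r′ = zag P r e in v , e′ , inj₁ r′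
                    ; (inj₂ (refl , refl)) e → let i , eq = children e in
                        c i , proj₁ w-parent i , inj₁ (subst (R (c i)) eq (c~c′ i)) }
          }
        ; fg = record
          { gens      = (w , p) ∷ gens F
          ; gens-in   = inj₂ (refl , refl) ∷ All.map inj₁ (gens-in F)
          ; generated = λ { (inj₁ r) → there (generated F r) ; (inj₂ (refl , _)) → here ε }
          }
        ; extends = inj₁
        ; bound   = λ { (v , inj₁ r) → inj₁ (v , r) ; (_ , inj₂ (refl , _)) → inj₂ refl }
        } , p , inj₂ (refl , refl)

    -- `room` supplies a cone of `H` that misses the finitely generated codomain, and any two cones
    -- are copies of the same tree.
    add-cone : ∀ {R} → PartialIso G H R → FG G H R → ∀ {w} → (∀ {u} → Path G w u → ¬ Dom R u) →
               Σ (Extends G H R (Path G w)) λ X → Dom (rel X) w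
    add-cone {R} P F {w} free-w = record
      { rel = R ∪ S
      ; iso = union P (span (treeEmb goodG w) (treeEmb goodH c))
          (λ { r (x , refl , _) → ⊥-elim (free-w (root-path (trees goodG w) x) (_ , r)) })
          (λ { r (x , _ , refl) → ⊥-elim (free-c (root-path (trees goodH c) x) (Anyₚ.map⁺ (generated (FG-converse P F) r))) })
      ; fg  = FG-union F (FG-cones (trees goodG w) (trees goodH c))
      ; extends = inj₁
      ; bound   = λ { (v , inj₁ r) → inj₁ (v , r) ; (_ , inj₂ (x , refl , _)) → inj₂ (root-path (trees goodG w) x) }
      } , c , inj₂ ([] , proj₂ (trees goodG w) , proj₂ (trees goodH c))
      where
      freeVertex = room goodH (map proj₁ (gens (FG-converse P F)))
      c : V H
      c = proj₁ freeVertex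
      free-c : Free goodH (map proj₁ (gens (FG-converse P F))) c
      free-c = proj₂ freeVertex
      S : Relation G H
      S = Span (treeEmb goodG w) (treeEmb goodH c)

    -- The induction on `Bar` keeps `B` fixed while `R` grows. Agreement is asked only below `w`,
    -- hence survives extensions on cones disjoint from that of `w`.
    Agrees : (V G → Set) → Relation G H → V G → Set
    Agrees B R w = ∀ {u} → Path G w u → (B u → Dom R u) × (Dom R u → B u)

    Extendable : (V G → Set) → V G → Set₁
    Extendable B w = ∀ {R} → PartialIso G H R → FG G H R → Agrees B R w →
                     Σ (Extends G H R (Path G w)) λ X → Dom (rel X) w

    extend-all : ∀ {B} k (c : Fin k → V G) → (∀ {i j} → i ≢ j → Disjoint G (c i) (c j)) →
                 (∀ i → Extendable B (c i)) →
                 ∀ {R} → PartialIso G H R → FG G H R → (∀ i → Agrees B R (c i)) →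
                 Σ (Extends G H R (λ u → ∃ λ i → Path G (c i) u)) λ X → ∀ i → Dom (rel X) (c i)
    extend-all zero c spread ext P F agrees = record
      { rel = _ ; iso = P ; fg = F ; extends = λ r → r ; bound = inj₁ } , λ ()
    extend-all (suc k) c spread ext P F agrees =
      let X , c₀∈X = ext zero P F (agrees zero)
          Y , c∈Y  = extend-all k (c ∘ suc) (λ i≢j → spread (i≢j ∘ Finₚ.suc-injective)) (ext ∘ suc) (iso X) (fg X)
            λ i p → (λ b → let v , r = proj₁ (agrees (suc i) p) b in v , extends X r) ,
                    λ d → [ proj₂ (agrees (suc i) p) , (λ p′ → ⊥-elim (spread {zero} {suc i} (λ ()) p′ p)) ]′ (bound X d)
      in record
      { rel = rel Y ; iso = iso Y ; fg = fg Y
      ; extends = λ r → extends Y (extends X r)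
      ; bound   = λ d → [ (λ d′ → [ inj₁ , (λ p → inj₂ (zero , p)) ]′ (bound X d′)) , (λ { (i , p) → inj₂ (suc i , p) }) ]′ (bound Y d)
      } , λ { zero → let v , r = c₀∈X in v , extends Y r ; (suc i) → c∈Y i }

    -- Induction on the bar: `inside` needs no extension, `outside` a new cone, and `below` first
    -- the children, whose cones are disjoint, and then `w` as a parent of them.
    extendable : ∀ {B w} → Bar G B w → Extendable B w
    extendable (inside b)  P F agrees = record
      { rel = _ ; iso = P ; fg = F ; extends = λ r → r ; bound = inj₁ } , proj₁ (agrees ε) b
    extendable (outside f) P F agrees = add-cone P F λ p d → f p (proj₂ (agrees p) d)
    extendable {B} {w} (below h) {R} P F agrees with trees goodG w
    ... | t , refl = result
      where
      c : Fin q → V G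
      c i = fun t (i ∷ [])

      w→c : ∀ i → E G (fun t []) (c i)
      w→c i = forth t (i , refl)

      children : ∀ {v} → E G (fun t []) v → ∃ λ i → c i ≡ v
      children e with back t e
      ... | _ , (i , refl) , eq = i , eq

      on-children : Σ (Extends G H R (λ u → ∃ λ i → Path G (c i) u)) λ X → ∀ i → Dom (rel X) (c i)
      on-children = extend-all q c (siblings-disjoint t) (λ i → extendable (h (w→c i))) P F (λ i p → agrees (w→c i ◅ p))

      X = proj₁ on-children

      bound-X : ∀ {u} → Dom (rel X) u → Dom R u ⊎ Path G (fun t []) u
      bound-X d = [ inj₁ , (λ { (i , p) → inj₂ (w→c i ◅ p) }) ]′ (bound X d)

      result : Σ (Extends G H R (Path G (fun t []))) λ X → Dom (rel X) (fun t [])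
      -- `below` does not exclude that the vertex lies in the domain already.
      result with lem {P = Dom (rel X) (fun t [])}
      ... | yes d = record { rel = rel X ; iso = iso X ; fg = fg X ; extends = extends X ; bound = bound-X } , d
      ... | no ¬d = let Y , w∈Y = add-parent (iso X) (fg X) (siblings-disjoint t) (w→c , children) ¬d
                                             (λ i → proj₂ (proj₂ on-children i))
        in record { rel = rel Y ; iso = iso Y ; fg = fg Y ; extends = λ r → extends Y (extends X r)
                  ; bound = λ d → [ bound-X , (λ { refl → inj₂ ε }) ]′ (bound Y d) } , w∈Y

    extend-to : ∀ {R} → PartialIso G H R → FG G H R → ∀ w → Σ (Extends G H R (Path G w)) λ X → Dom (rel X) w
    -- The bar is taken for the descendants of the generators of the domain, which make up exactly
    -- `Dom R`.
    extend-to {R} P F w = extendable (bars-descendants goodG X w) P F λ _ → inDom (gens-in F) , λ d → Anyₚ.map⁺ (generated F (proj₂ d))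
      where
      X = map proj₁ (gens F)
      inDom : ∀ {u L} → All (λ g → R (proj₁ g) (proj₂ g)) L → Descendants G (map proj₁ L) u → Dom R u
      inDom (r ∷ _)  (here p)  = Dom-closed P (_ , r) p
      inDom (_ ∷ rs) (there d) = inDom rs d

-- Back-and-forth.

module BackAndForth (lem : ExcludedMiddle 0ℓ) (r : ℕ) {G H : Digraph}
  (goodG : Good (suc (suc r)) G) (goodH : Good (suc (suc r)) H)
  (spec⇒ : ∀ {m} → Emb (𝒯 (suc (suc r)) m) G → Emb (𝒯 (suc (suc r)) m) H)
  (spec⇐ : ∀ {m} → Emb (𝒯 (suc (suc r)) m) H → Emb (𝒯 (suc (suc r)) m) G) where
  open Extension lem r

  record Stage : Set₁ where
    field
      rel : Relation G H
      iso : PartialIso G H rel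
      fg  : FG G H rel
  open Stage

  _⊑_ : Stage → Stage → Set
  S ⊑ T = ∀ {u v} → rel S u v → rel T u v

  initial : Stage
  initial = record
    { rel = λ _ _ → ⊥
    ; iso = record { functional = λ () ; injective = λ () ; zig = λ () ; zag = λ () }
    ; fg  = record { gens = [] ; gens-in = [] ; generated = λ () }
    }

  add-left : ∀ S u → Σ Stage λ T → S ⊑ T × Dom (rel T) u
  add-left S u = let X , d = extend-to goodG goodH spec⇒ (iso S) (fg S) u in
    record { rel = Extends.rel X ; iso = Extends.iso X ; fg = Extends.fg X } , Extends.extends X , d

  add-right : ∀ S v → Σ Stage λ T → S ⊑ T × Cod (rel T) v
  add-right S v =
    let X , d = extend-to goodH goodG spec⇐ (converse (iso S)) (FG-converse (iso S) (fg S)) v in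
    record { rel = flip (Extends.rel X) ; iso = converse (Extends.iso X)
           ; fg = FG-converse (Extends.iso X) (Extends.fg X) } , Extends.extends X , d

  codeG : V G → ℕ
  codeG = proj₁ (countable goodG)

  codeH : V H → ℕ
  codeH = proj₁ (countable goodH)

  -- The code need not be onto; a number that codes no vertex leaves the stage as it is.
  meet-left : ∀ S n → Σ Stage λ T → S ⊑ T × (∀ {u} → codeG u ≡ n → Dom (rel T) u)
  meet-left S n with lem {P = ∃ λ u → codeG u ≡ n}
  ... | no ¬u = S , (λ s → s) , λ eq → ⊥-elim (¬u (_ , eq))
  ... | yes (u , eq) with add-left S u
  ...   | T , S⊑T , d = T , S⊑T , λ eq′ → subst (Dom (rel T)) (proj₂ (countable goodG) (trans eq (sym eq′))) d

  meet-right : ∀ S n → Σ Stage λ T → S ⊑ T × (∀ {v} → codeH v ≡ n → Cod (rel T) v)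
  meet-right S n with lem {P = ∃ λ v → codeH v ≡ n}
  ... | no ¬v = S , (λ s → s) , λ eq → ⊥-elim (¬v (_ , eq))
  ... | yes (v , eq) with add-right S v
  ...   | T , S⊑T , d = T , S⊑T , λ eq′ → subst (Cod (rel T)) (proj₂ (countable goodH) (trans eq (sym eq′))) d

  next : Stage → ℕ → Stage
  next S n = proj₁ (meet-right (proj₁ (meet-left S n)) n)

  stages : ℕ → Stage
  stages zero    = initial
  stages (suc n) = next (stages n) n

  grow : ∀ n → stages n ⊑ stages (suc n)
  grow n s = proj₁ (proj₂ (meet-right _ n)) (proj₁ (proj₂ (meet-left (stages n) n)) s)

  mono : ∀ m n → stages n ⊑ stages (m + n)
  mono zero    n s = s
  mono (suc m) n s = grow (m + n) (mono m n s)

  Limit : Relation G H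
  Limit u v = ∃ λ n → rel (stages n) u v

  common : ∀ {u v u′ v′} → Limit u v → Limit u′ v′ → ∃ λ n → rel (stages n) u v × rel (stages n) u′ v′
  common {u} {v} (m , s) (n , s′) = m + n , subst (λ k → rel (stages k) u v) (ℕₚ.+-comm n m) (mono n m s) , mono m n s′

  limit-iso : PartialIso G H Limit
  limit-iso = record
    { functional = λ l l′ → let n , s , s′ = common l l′ in functional (iso (stages n)) s s′
    ; injective  = λ l l′ → let n , s , s′ = common l l′ in injective (iso (stages n)) s s′
    ; zig = λ { (n , s) e → let v , e′ , s′ = zig (iso (stages n)) s e in v , e′ , n , s′ }
    ; zag = λ { (n , s) e → let v , e′ , s′ = zag (iso (stages n)) s e in v , e′ , n , s′ }
    }

  total-left : ∀ u → Dom Limit u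
  total-left u = let v , s = proj₂ (proj₂ (meet-left (stages (codeG u)) (codeG u))) refl in
    v , suc (codeG u) , proj₁ (proj₂ (meet-right _ (codeG u))) s

  total-right : ∀ v → Cod Limit v
  total-right v = let u , s = proj₂ (proj₂ (meet-right (proj₁ (meet-left (stages (codeH v)) (codeH v))) (codeH v))) refl in
    u , suc (codeH v) , s

  isomorphic : Iso G H
  isomorphic = record
    { to       = λ u _ → proj₁ (total-left u)
    ; to-Q     = λ _ _ → tt
    ; from     = λ v _ → proj₁ (total-right v)
    ; from-P   = λ _ _ → tt
    ; to-irr   = λ _ _ _ → refl
    ; from-irr = λ _ _ _ → refl
    ; left     = λ u _ → injective limit-iso (proj₂ (total-right _)) (proj₂ (total-left u))
    ; right    = λ v _ → functional limit-iso (proj₂ (total-left _)) (proj₂ (total-right v))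
    ; edges    = λ u v _ _ → mk⇔ (edge⇒ limit-iso (proj₂ (total-left u)) (proj₂ (total-left v)))
                                 (edge⇒ (converse limit-iso) (proj₂ (total-left u)) (proj₂ (total-left v)))
    }

-- Restriction of embeddings, and the digraphs `𝒯 q m`.

-- Moves embeddings from a digraph into a digraph embedded in it, such as a member of a class that
-- represents one of its closed parts.
factor : ∀ {A B G} (ι : Emb A G) (e : Emb B G) → (∀ b → Image ι (fun e b)) →
         Σ (Emb B A) λ f → ∀ b → fun ι (fun f b) ≡ fun e b
factor {A} {B} {G} ι e into = record
  { fun   = f
  ; inj   = λ {u} {v} eq → inj e (trans (sym (ι-f u)) (trans (cong (fun ι) eq) (ι-f v)))
  ; forth = λ {u} {v} d → edge⁻ ι (subst₂ (E G) (sym (ι-f u)) (sym (ι-f v)) (forth e d))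
  ; back  = λ {u} {v} d → let b , d′ , eq = back e (subst (λ x → E G x (fun ι v)) (ι-f u) (forth ι d))
                          in b , d′ , inj ι (trans (ι-f b) eq)
  } , ι-f
  where
  f : V B → V A
  f b = proj₁ (into b)
  ι-f : ∀ b → fun ι (f b) ≡ fun e b
  ι-f b = proj₂ (into b)

treeAt-restrict : ∀ {q A G} (e : Emb A G) {a} → TreeAt q G (fun e a) → TreeAt q A a
treeAt-restrict e {a} (t , t[]) =
  let f , eq = factor e t (λ w → let v , _ , eq = lift e (root-path (t , t[]) w) in v , eq)
  in f , inj e (trans (eq []) t[])

-- Consequently the `m` for which `𝒯 q m` embeds form an initial segment, determined by one
-- threshold.
𝒯-mono : ∀ {q m n} → m ≤ n → Emb (𝒯 q m) (𝒯 q n)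
𝒯-mono {q} {m} {n} m≤n = record { fun = f ; inj = f-inj ; forth = f-forth ; back = f-back }
  where
  f : TnV q m → TnV q n
  f (old i w) = old i w
  f (new x)   = new (inject≤ x m≤n)

  new-inj : ∀ {x y : Fin n} → new {q} x ≡ new y → x ≡ y
  new-inj refl = refl

  f-inj : ∀ {u v} → f u ≡ f v → u ≡ v
  f-inj {old _ _} {old _ _} refl = refl
  f-inj {new _}   {new _}   eq   = cong new (Finₚ.inject≤-injective m≤n m≤n _ _ (new-inj eq))

  f-forth : ∀ {u v} → TnEdge q m u v → TnEdge q n (f u) (f v)
  f-forth (oldE i w k) = oldE i w k
  f-forth (newE x i)   = newE (inject≤ x m≤n) i

  f-back : ∀ {u v} → TnEdge q n (f u) v → ∃ λ u′ → TnEdge q m u u′ × f u′ ≡ v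
  f-back {old i w} (oldE _ _ k) = old i (w ∷ʳ k) , oldE i w k , refl
  f-back {new x}   (newE _ i)   = old i [] , newE x i , refl

-- The vertices `old i []` are listed too, since for `m = 0` there is no new vertex above them.
𝒯-gens : ∀ q m → List (TnV q m)
𝒯-gens q m = map new (allFin m) ++ map (λ i → old i []) (allFin q)

𝒯-generated : ∀ {q m} v → Descendants (𝒯 q m) (𝒯-gens q m) v
𝒯-generated {q} {m} (new x)   = Anyₚ.++⁺ˡ (Anyₚ.map⁺ (lose (∈-allFin x) ε))
𝒯-generated {q} {m} (old i w) = Anyₚ.++⁺ʳ (map new (allFin m)) (Anyₚ.map⁺ (lose (∈-allFin i)
  (subst (λ v → Path (𝒯 q m) (old i []) (old i v)) (Listₚ.reverse-involutive w) (go (reverse w)))))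
  where
  go : ∀ v → Path (𝒯 q m) (old i []) (old i (reverse v))
  go []      = ε
  go (k ∷ v) = go v ◅◅ (subst (TnEdge q m _ ∘ old i) (sym (Listₚ.unfold-reverse k v)) (oldE i (reverse v) k) ◅ ε)

TEdge-inv : ∀ {q w v} → TEdge q w v → ∃ λ i → v ≡ w ∷ʳ i
TEdge-inv (child w i) = i , refl

-- Translation to and from the definitions of the theorem.

module Translation (lem : ExcludedMiddle 0ℓ) where

  Emb⇒DCEmbedding : ∀ {A G} → Emb A G → DCEmbedding A G
  Emb⇒DCEmbedding {G = G} e = record
    { emb        = fun e
    ; emb-inj    = inj e
    ; emb-edges  = λ u v → mk⇔ (forth e) (edge⁻ e)
    ; emb-closed = λ { _ _ (u , refl) d → let v , _ , eq = lift e (desc⇒path G d) in v , eq }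
    }

  DCEmbedding⇒Emb : ∀ {A G} → DCEmbedding A G → Emb A G
  DCEmbedding⇒Emb {G = G} e = record
    { fun   = emb
    ; inj   = emb-inj
    ; forth = λ d → ⇒ (emb-edges _ _) d
    ; back  = λ {u} {v} d → let w , eq = emb-closed _ v (u , refl) (path⇒desc lem G (d ◅ ε))
                            in w , ⇐ (emb-edges u w) (subst (E G (emb u)) (sym eq) d) , eq
    }
    where open DCEmbedding e

  SubIso⇒Emb : ∀ {A G B} → DescClosed G B → SubIso A G (Full A) B →
               Σ (Emb A G) λ e → ∀ {v} → B v → Image e v
  SubIso⇒Emb {A} {G} {B} closed φ = record
    { fun   = λ a → to φ a tt
    ; inj   = λ {u} {v} eq → trans (sym (left φ u tt)) (trans (from-≡ eq) (left φ v tt))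
    ; forth = λ d → ⇒ (edges φ _ _ tt tt) d
    ; back  = λ {u} {v} d →
        let b = closed _ v (to-Q φ u tt) (path⇒desc lem G (d ◅ ε))
        in from φ v b , ⇐ (edges φ _ _ tt tt) (subst (E G (to φ u tt)) (sym (right φ v b)) d) , right φ v b
    } , λ {v} b → from φ v b , right φ v b
    where
    from-≡ : ∀ {v w} {b : B v} {c : B w} → v ≡ w → from φ v b ≡ from φ w c
    from-≡ refl = from-irr φ _ _ _

  SubIso⇒TreeAt : ∀ {q G u} → SubIso G (Tree q) (desc G u) (Full (Tree q)) → TreeAt q G u
  SubIso⇒TreeAt {q} {G} {u} φ = t , root
    where
    f : List (Fin q) → V G
    f w = from φ (reverse w) tt

    f-desc : ∀ w → desc G u (f w)
    f-desc w = from-P φ (reverse w) tt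

    f-right : ∀ w → to φ (f w) (f-desc w) ≡ reverse w
    f-right w = right φ (reverse w) tt

    f-left : ∀ {v} (d : desc G u v) → f (reverse (to φ v d)) ≡ v
    f-left {v} d = trans (cong (λ w → from φ w tt) (Listₚ.reverse-involutive (to φ v d))) (left φ v d)

    f-back : ∀ {w v} → E G (f w) v → ∃ λ w′ → E (RTree q) w w′ × f w′ ≡ v
    f-back {w} {v} e =
      let d = path⇒desc lem G (desc⇒path G (f-desc w) ◅◅ (e ◅ ε))
          i , eq = TEdge-inv (⇒ (edges φ (f w) v (f-desc w) d) e)
          eq′ : to φ v d ≡ reverse (i ∷ w)
          eq′ = trans eq (trans (cong (_∷ʳ i) (f-right w)) (sym (Listₚ.unfold-reverse i w)))
      in i ∷ w , (i , refl) , trans (cong (λ x → from φ x tt) (sym eq′)) (left φ v d)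

    f-forth : ∀ w i → E G (f w) (f (i ∷ w))
    f-forth w i = ⇐ (edges φ (f w) (f (i ∷ w)) (f-desc w) (f-desc (i ∷ w)))
      (subst₂ (TEdge q) (sym (f-right w)) (sym (trans (f-right (i ∷ w)) (Listₚ.unfold-reverse i w)))
              (child (reverse w) i))

    t : Emb (RTree q) G
    t = record
      { fun   = f
      ; inj   = λ {w} {v} eq → Listₚ.reverse-injective (trans (sym (f-right w)) (trans (to-≡ eq) (f-right v)))
      ; forth = λ { {w} (i , refl) → f-forth w i }
      ; back  = f-back
      }
      where
      to-≡ : ∀ {v w} {d : desc G u v} {d′ : desc G u w} → v ≡ w → to φ v d ≡ to φ w d′
      to-≡ refl = to-irr φ _ _ _

    -- The given isomorphism is not assumed to match `u` with the empty word. But `u` is `f a` for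
    -- some `a` and reaches `f []`, so `a` is a suffix of the empty word.
    root : f [] ≡ u
    root with reverse (to φ u ([] , tt , refl)) | f-left ([] , tt , refl)
    ... | a | fa≡u with RTree-path⁻ (path⁻ t (subst (λ v → Path G v (f [])) (sym fa≡u) (desc⇒path G (f-desc []))))
    ...   | x , eq with Listₚ.++-conicalʳ x a (sym eq)
    ...     | refl = fa≡u

  TreeAt⇒SubIso : ∀ {q G u} → TreeAt q G u → SubIso G (Tree q) (desc G u) (Full (Tree q))
  TreeAt⇒SubIso {q} {G} {u} T@(t , _) = record
    { to       = λ v d → reverse (word d)
    ; to-Q     = λ _ _ → tt
    ; from     = λ w _ → fun t (reverse w)
    ; from-P   = λ w _ → path⇒desc lem G (root-path T (reverse w))
    ; to-irr   = λ _ d d′ → cong reverse (inj t (trans (word-≡ d) (sym (word-≡ d′))))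
    ; from-irr = λ _ _ _ → refl
    ; left     = λ v d → trans (cong (fun t) (Listₚ.reverse-involutive (word d))) (word-≡ d)
    ; right    = λ w _ → trans (cong reverse (inj t (word-≡ (path⇒desc lem G (root-path T (reverse w))))))
                               (Listₚ.reverse-involutive w)
    ; edges    = λ v v′ d d′ → mk⇔
        (λ e → to-edge (edge⁻ t (subst₂ (E G) (sym (word-≡ d)) (sym (word-≡ d′)) e)))
        (λ e → subst₂ (E G) (word-≡ d) (word-≡ d′) (forth t (from-edge e)))
    }
    where
    word : ∀ {v} → desc G u v → List (Fin q)
    word d = proj₁ (descend T (desc⇒path G d))

    word-≡ : ∀ {v} (d : desc G u v) → fun t (word d) ≡ v
    word-≡ d = proj₂ (descend T (desc⇒path G d))

    to-edge : ∀ {w w′} → E (RTree q) w w′ → TEdge q (reverse w) (reverse w′)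
    to-edge {w} (i , refl) = subst (TEdge q (reverse w)) (sym (Listₚ.unfold-reverse i w)) (child (reverse w) i)

    from-edge : ∀ {w w′} → TEdge q (reverse w) (reverse w′) → E (RTree q) w w′
    from-edge {w} e = let i , eq = TEdge-inv e in
      i , Listₚ.reverse-injective (trans eq (sym (Listₚ.unfold-reverse i w)))

  finGen-Image : ∀ {A G} (e : Emb A G) (X : List (V A)) → (∀ v → Descendants A X v) → FinGen G (Image e)
  finGen-Image {A} {G} e X gen =
    (λ { _ _ (u , refl) d → let v , _ , eq = lift e (desc⇒path G d) in v , eq }) ,
    map (fun e) X ,
    λ v → mk⇔ (λ { (u , refl) → Anyₚ.map⁺ (Any.map (λ p → path⇒desc lem G (path e p)) (gen u)) })
              (λ d → let x , p = Any.satisfied (Anyₚ.map⁻ d) ; u , _ , eq = lift e (desc⇒path G p) in u , eq)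

  -- Induction on the bar, collecting the generators found below the finitely many children. A
  -- vertex already in `B` is its own generator, which the children could not supply.
  bar⇒gens : ∀ {q G B u} → (∀ v → TreeAt q G v) → Bar G B u →
             ∃ λ X → All (λ x → Path G u x × B x) X × (∀ {v} → Path G u v → B v → Descendants G X v)
  bar⇒gens {u = u} trees (inside b) = u ∷ [] , (ε , b) ∷ [] , λ p _ → here p
  bar⇒gens trees (outside f) = [] , [] , λ p b → ⊥-elim (f p b)
  bar⇒gens {q} {G} {B} {u} trees (below h) with lem {P = B u}
  ... | yes b = u ∷ [] , (ε , b) ∷ [] , λ p _ → here p
  ... | no ¬b with trees u
  ...   | t , refl = concat (map X (allFin q)) ,
      Allₚ.concat⁺ (Allₚ.map⁺ (All.tabulate {xs = allFin q} λ {i} _ →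
        All.map (λ { (p , b) → forth t (i , refl) ◅ p , b }) (proj₁ (proj₂ (rec i))))) ,
      covers
    where
    rec : ∀ i → ∃ λ X → All (λ x → Path G (fun t (i ∷ [])) x × B x) X ×
                        (∀ {v} → Path G (fun t (i ∷ [])) v → B v → Descendants G X v)
    rec i = bar⇒gens trees (h (forth t (i , refl)))
    X : Fin q → List (V G)
    X i = proj₁ (rec i)
    covers : ∀ {v} → Path G (fun t []) v → B v → Descendants G (concat (map X (allFin q))) v
    covers ε b = ⊥-elim (¬b b)
    covers (e ◅ p) b with back t e
    ... | _ , (i , refl) , refl = Anyₚ.concat⁺ (Anyₚ.map⁺ (lose (∈-allFin i) (proj₂ (proj₂ (rec i)) p b)))

  -- Membership in the classes.

  module _ (r : ℕ) where
    open Extension lem r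

    -- Since the image is descendant-closed, cones of `A` are cones of `G`; the bars of `G` pull
    -- back along `e` and yield generators of the intersections.
    inC : ∀ {A G} → Good q G → Emb A G → (X : List (V A)) → (∀ v → Descendants A X v) → InC q A
    inC {A} {G} good e X gen =
      (λ a → TreeAt⇒SubIso (treesA a)) ,
      (X , λ v → Any.map (path⇒desc lem A) (gen v)) ,
      λ a b → (λ { x v (p , p′) d → path⇒desc lem A (desc⇒path A p ◅◅ desc⇒path A d) ,
                                    path⇒desc lem A (desc⇒path A p′ ◅◅ desc⇒path A d) }) ,
              intersection a b
      where
      treesA : ∀ a → TreeAt q A a
      treesA a = treeAt-restrict e (trees good (fun e a))

      intersection : ∀ a b → Σ (List (V A)) λ Y → ∀ v → (desc A a v × desc A b v) ⇔ descL A Y v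
      intersection a b with bar⇒gens treesA (bar-weaken (path⁻ e) (λ _ → path e) (bar-comap e (bars good (fun e a) (fun e b))))
      ... | Y , in-Y , gen-Y = Y , λ v → mk⇔
        (λ { (d , d′) → Any.map (path⇒desc lem A) (gen-Y (desc⇒path A d) (desc⇒path A d′)) })
        (λ d → from-Y in-Y d)
        where
        from-Y : ∀ {Z v} → All (λ x → Path A a x × Path A b x) Z → descL A Z v → desc A a v × desc A b v
        from-Y ((p , p′) ∷ _) (here d) = path⇒desc lem A (p ◅◅ desc⇒path A d) , path⇒desc lem A (p′ ◅◅ desc⇒path A d)
        from-Y (_ ∷ ps) (there d)      = from-Y ps d

    𝒯-inC : ∀ {G m} → Good q G → Emb (𝒯 q m) G → InC q (𝒯 q m)
    𝒯-inC {m = m} good e = inC good e (𝒯-gens q m) 𝒯-generated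

    module _ {K : Digraph → Set} {G : Digraph} (char : Characterises K G) where

      member-embeds : ∀ {A} → K A → Emb A G
      member-embeds k = let B , fin , φ = proj₂ (proj₂ (proj₂ char)) _ k in proj₁ (SubIso⇒Emb (proj₁ fin) φ)

      -- The image of `𝒯 q m` is finitely generated and descendant-closed, hence represented by a
      -- member of `K`. This brings the restriction that defines `InCn` to bear on `G`.
      embedded-in-member : ∀ {m} → Emb (𝒯 q m) G → Σ Digraph λ A → K A × Emb (𝒯 q m) A
      embedded-in-member {m} e =
        let fin = finGen-Image e (𝒯-gens q m) 𝒯-generated
            A , k , φ = proj₁ (proj₂ (proj₂ char)) _ fin
            ι , onto = SubIso⇒Emb (proj₁ fin) φ
        in A , k , proj₁ (factor ι e (λ b → onto (b , refl)))

      -- The descendant set of `u` is generated by `u`, so it is represented by a member of `K`, in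
      -- which cones are trees.
      characterised-good : (∀ {A} → K A → InC q A) → V G → Good q G
      characterised-good K⊆C v = record
        { countable   = proj₁ char
        ; homogeneous = proj₁ (proj₂ char)
        ; trees       = tree
        ; vertex      = v
        }
        where
        tree : ∀ u → TreeAt q G u
        tree u =
          let fin : FinGen G (desc G u)
              fin = (λ a v d d′ → path⇒desc lem G (desc⇒path G d ◅◅ desc⇒path G d′)) ,
                    u ∷ [] , λ v → mk⇔ here (λ { (here d) → d ; (there ()) })
              A , k , φ = proj₁ (proj₂ (proj₂ char)) _ fin
              ι , onto  = SubIso⇒Emb (proj₁ fin) φ
              a , ιa≡u  = onto ([] , tt , refl)
              t , t[]   = SubIso⇒TreeAt (proj₁ (K⊆C k) a)
          in ι ∘ᴱ t , trans (cong (fun ι) t[]) ιa≡u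

    -- `𝒯 q 1` is the tree itself up to isomorphism, so the cone of any vertex will do.
    single-embeds : ∀ {G} → Good q G → Emb (𝒯 q 1) G
    single-embeds {G} good =
      let t , _ = trees good (vertex good) in
      parents⇒emb good {c = λ i → fun t (i ∷ [])} (siblings-disjoint t)
        ((λ _ → fun t []) , (λ { {zero} {zero} _ → refl }) , λ _ →
         (λ i → forth t (i , refl)) , λ e → child-of t (back t e))
      where
      child-of : ∀ (t : Emb (RTree q) G) {v} → (∃ λ w → E (RTree q) [] w × fun t w ≡ v) → ∃ λ i → fun t (i ∷ []) ≡ v
      child-of t (_ , (i , refl) , eq) = i , eq

-- The threshold and the conclusion.

least : ExcludedMiddle 0ℓ → (P : ℕ → Set) → (∀ n → P n) ⊎ ∃ λ n → ¬ P n × (∀ {m} → m < n → P m)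
least lem P with lem {P = ∃ λ n → ¬ P n × (∀ {m} → m < n → P m)}
... | yes l = inj₂ l
... | no ¬l = inj₁ λ n → <-rec P (λ n rec → by-cases n rec) n
  where
  by-cases : ∀ n → (∀ {m} → m < n → P m) → P n
  by-cases n rec with lem {P = P n}
  ... | yes p = p
  ... | no ¬p = ⊥-elim (¬l (n , ¬p , rec))

theorem2p5 : (q : ℕ) → 2 ≤ q →
    (∀ {ℓ : Level} → ExcludedMiddle ℓ) →
    (D∞ : Digraph) → Characterises (InC q) D∞ →
    (Dn : ℕ → Digraph) → ((n : ℕ) → 2 ≤ n → Characterises (InCn q n) (Dn n)) →
    (D : Digraph) → Countable D → V D → DescHomogeneous D →
    ((u : V D) → SubIso D (Tree q) (desc D u) (Full (Tree q))) →
    (Σ ℕ λ n → 2 ≤ n × Iso D (Dn n)) ⊎ Iso D D∞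
theorem2p5 (suc (suc r)) (s≤s (s≤s _)) em D∞ char∞ Dn charₙ D cnt v hom treesD = result
  where
  open Translation em
  open Extension em r using (q)

  good : Good q D
  good = record { countable = cnt ; homogeneous = hom ; trees = λ u → SubIso⇒TreeAt (treesD u) ; vertex = v }

  result : (Σ ℕ λ n → 2 ≤ n × Iso D (Dn n)) ⊎ Iso D D∞
  result with least em (λ m → Emb (𝒯 q m) D)
  ... | inj₁ all = inj₂ (BackAndForth.isomorphic em r good good∞ (λ {m} _ → spec m) (λ {m} _ → all m))
    where
    spec : ∀ m → Emb (𝒯 q m) D∞
    spec m = member-embeds r char∞ (𝒯-inC r good (all m))

    good∞ : Good q D∞
    -- The required vertex of `D∞` is the new vertex of a copy of `𝒯 q 1`.
    good∞ = characterised-good r char∞ (λ k → k) (fun (spec 1) (new zero))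
  ... | inj₂ (zero , ¬0 , _) = ⊥-elim (¬0 (single-embeds r good ∘ᴱ 𝒯-mono z≤n))
  ... | inj₂ (suc zero , ¬1 , _) = ⊥-elim (¬1 (single-embeds r good))
  ... | inj₂ (n@(suc (suc _)) , ¬n , below-n) =
    inj₁ (n , s≤s (s≤s z≤n) , BackAndForth.isomorphic em r good goodₙ spec⇒ spec⇐)
    where
    char = charₙ n (s≤s (s≤s z≤n))

    spec⇒ : ∀ {m} → Emb (𝒯 q m) D → Emb (𝒯 q m) (Dn n)
    -- A copy of `𝒯 q n` inside `𝒯 q m` would give one in `D`; so `𝒯 q m` belongs to the class of
    -- `Dn n`.
    spec⇒ e = member-embeds r char (𝒯-inC r good e , λ dc → ¬n (e ∘ᴱ DCEmbedding⇒Emb dc))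

    spec⇐ : ∀ {m} → Emb (𝒯 q m) (Dn n) → Emb (𝒯 q m) D
    spec⇐ {m} e with embedded-in-member r char e | m ℕₚ.<? n
    ... | _ | yes m<n = below-n m<n
    -- For `n ≤ m` the representing member `A` would contain `𝒯 q n`, which its class forbids.
    ... | A , (_ , ¬𝒯n) , e′ | no m≮n = ⊥-elim (¬𝒯n (Emb⇒DCEmbedding (e′ ∘ᴱ 𝒯-mono (ℕₚ.≮⇒≥ m≮n))))

    goodₙ : Good q (Dn n)
    goodₙ = characterised-good r char proj₁ (fun (spec⇒ (single-embeds r good)) (new zero))
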